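{- Let $b,w$ be positive integers. If $b\neq w$, then $$(2b-1)(2w-1)+(b+w-1)^2\le h_{b\times w}\le \frac{(2bw)^{2bw+1}}{(2bw-1)^{2bw-1}}.$$ If $b=w$, then $$(2b-1)^2\le h_{b\times w}\le \frac{(b^2)^{2b^2+1}}{(b^2-1)^{2b^2-1}},$$ where for $b=w=1$ the right-hand side (which has zero denominator) is interpreted as $+\infty$.
   Context: Let $b,w$ be positive integers. A $b\times w$ block is a subset of $\mathbb{R}^3$ of the form $[x,x+b]\times[y,y+w]\times[z,z+1]$ or $[x,x+w]\times[y,y+b]\times[z,z+1]$ with $x,y,z\in\mathbb{Z}$. A building is a finite set of blocks with pairwise disjoint interiors. Two blocks of a building are attached if their $z$-coordinates differ by exactly $1$ and their projections to the $xy$-plane overlap in a set with nonempty interior (i.e. at least one stud of the lower block is inserted into the upper block). A building is contiguous if the graph on its blocks given by attachment is connected. Two buildings are identified if one is mapped onto the other by a composition of translations of $\mathbb{R}^3$ and rotations about vertical axes (rotations in the $xy$-plane, by multiples of $90^\circ$). $T_{b\times w}(n)$ denotes the number of contiguous buildings consisting of exactly $n$ blocks of dimension $b\times w$, counted up to this identification. The entropy is $s_{b\times w}=\lim_{n\to\infty}\frac{\log(T_{b\times w}(n))}{n}$ (this limit exists and is finite), and $h_{b\times w}=\exp(s_{b\times w})$. -}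

module Defs where

open import Algebra.Bundles using (CommutativeRing)
open import Data.Empty using (⊥; ⊥-elim)
open import Data.Fin.Base using (Fin)
open import Data.Integer.Base as ℤ using (ℤ; 0ℤ; +_)
import Data.Integer.Properties as ℤ
open import Data.Nat.Base as ℕ using (ℕ; zero; suc)
open import Data.Nat.GeneralisedArithmetic using (fold; fold-+)
import Data.Nat.Properties as ℕ
open import Data.Product.Base using (∃; ∃₂; _×_; _,_; proj₁; proj₂)
open import Data.Rational.Base
open import Data.Rational.Properties hiding (*-monoˡ-≤-pos; *-monoʳ-≤-pos)
open import Data.Rational.Solver using (module +-*-Solver)
import Data.Rational.Unnormalised.Base as ℚᵘ
import Data.Rational.Unnormalised.Properties as ℚᵘ
open import Data.Sum.Base as Sum using (_⊎_; inj₁; inj₂)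
open import Data.Unit.Base using (⊤)
open import Data.Vec.Functional using (Vector)
open import Function.Base using (_∘_)
open import Function.Bundles using (Bijection)
open import Level using (0ℓ)
open import Relation.Binary.Bundles using (Setoid)
open import Relation.Binary.Construct.Closure.ReflexiveTransitive using (Star)
open import Relation.Binary.Definitions using (tri<; tri≈; tri>)
open import Relation.Binary.PropositionalEquality
open import Relation.Nullary using (¬_; yes; no)
open import Relation.Unary using (Pred)

open import Algebra.Properties.CommutativeSemiring.Exp
  (CommutativeRing.commutativeSemiring +-*-commutativeRing)
  using (_^_; ^-distrib-*; ^-assocʳ)

open +-*-Solver using (solve; _:=_; _:+_; _:*_; _:-_; :-_; con)

ι : ℕ → ℚ
ι n = + n / 1

inv : ℕ → ℚ
inv k = + 1 / suc k

ι-suc : ∀ n → ι (suc n) ≡ 1ℚ + ι n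
ι-suc n = toℚᵘ-injective (begin
  toℚᵘ (ι (suc n))                          ≈⟨ toℚᵘ-fromℚᵘ (ℚᵘ.mkℚᵘ (+ suc n) 0) ⟩
  ℚᵘ.mkℚᵘ (+ suc n) 0                       ≈⟨ ℚᵘ.*≡* (cong (ℤ._* + 1) (cong (ℤ._+_ (+ 1)) (sym (ℤ.*-identityʳ (+ n))))) ⟩
  ℚᵘ.1ℚᵘ ℚᵘ.+ ℚᵘ.mkℚᵘ (+ n) 0               ≈⟨ ℚᵘ.+-congʳ ℚᵘ.1ℚᵘ (ℚᵘ.≃-sym (toℚᵘ-fromℚᵘ (ℚᵘ.mkℚᵘ (+ n) 0))) ⟩
  ℚᵘ.1ℚᵘ ℚᵘ.+ toℚᵘ (ι n)                    ≈⟨ ℚᵘ.≃-sym (toℚᵘ-homo-+ 1ℚ (ι n)) ⟩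
  toℚᵘ (1ℚ + ι n)                           ∎)
  where open ℚᵘ.≃-Reasoning

ι-inv : ∀ k → ι (suc k) * inv k ≡ 1ℚ
ι-inv k = toℚᵘ-injective (begin
  toℚᵘ (ι (suc k) * inv k)                  ≈⟨ toℚᵘ-homo-* (ι (suc k)) (inv k) ⟩
  toℚᵘ (ι (suc k)) ℚᵘ.* toℚᵘ (inv k)        ≈⟨ ℚᵘ.*-cong (toℚᵘ-fromℚᵘ (ℚᵘ.mkℚᵘ (+ suc k) 0)) (toℚᵘ-fromℚᵘ (ℚᵘ.mkℚᵘ (+ 1) k)) ⟩
  ℚᵘ.mkℚᵘ (+ suc k) 0 ℚᵘ.* ℚᵘ.mkℚᵘ (+ 1) k  ≈⟨ ℚᵘ.*≡* (cong +_ (cong suc (trans (ℕ.*-identityʳ _) (trans (ℕ.*-identityʳ k) (sym (trans (ℕ.+-identityʳ _) (ℕ.+-identityʳ k))))))) ⟩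
  ℚᵘ.1ℚᵘ                                    ∎)
  where open ℚᵘ.≃-Reasoning

0≤ι : ∀ n → 0ℚ ≤ ι n
0≤ι n = nonNegative⁻¹ (ι n) {{normalize-nonNeg n 1}}

0<ι-suc : ∀ n → 0ℚ < ι (suc n)
0<ι-suc n = subst (0ℚ <_) (sym (ι-suc n)) (+-mono-<-≤ (positive⁻¹ 1ℚ) (0≤ι n))

0<inv : ∀ k → 0ℚ < inv k
0<inv k = positive⁻¹ (inv k) {{normalize-pos 1 (suc k)}}

ι-mono : ∀ {m n} → m ℕ.≤ n → ι m ≤ ι n
ι-mono {n = n} ℕ.z≤n = 0≤ι n
ι-mono {suc m} {suc n} (ℕ.s≤s m≤n) =
  subst₂ _≤_ (sym (ι-suc m)) (sym (ι-suc n)) (+-monoʳ-≤ 1ℚ (ι-mono m≤n))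

archimedean : ∀ p → ∃ λ n → p < ι (suc n)
archimedean p@(mkℚ i d _) = ℤ.∣ i ∣ , toℚᵘ-cancel-< (ℚᵘ.<-respʳ-≃ (ℚᵘ.≃-sym (toℚᵘ-fromℚᵘ (ℚᵘ.mkℚᵘ (+ suc ℤ.∣ i ∣) 0))) (ℚᵘ.*<* bound))
  where
  open ℤ.≤-Reasoning
  i≤ : ∀ i → i ℤ.≤ + ℤ.∣ i ∣
  i≤ (+ _)       = ℤ.≤-refl
  i≤ ℤ.-[1+ _ ]  = ℤ.-≤+
  bound : i ℤ.* + 1 ℤ.< + suc ℤ.∣ i ∣ ℤ.* + suc d
  bound = begin-strict
    i ℤ.* + 1                      ≡⟨ ℤ.*-identityʳ i ⟩
    i                              ≤⟨ i≤ i ⟩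
    + ℤ.∣ i ∣                      <⟨ ℤ.+<+ (ℕ.n<1+n _) ⟩
    + suc ℤ.∣ i ∣                  ≤⟨ ℤ.+≤+ (ℕ.m≤m*n (suc ℤ.∣ i ∣) (suc d)) ⟩
    + (suc ℤ.∣ i ∣ ℕ.* suc d)      ≡⟨ ℤ.pos-* (suc ℤ.∣ i ∣) (suc d) ⟩
    + suc ℤ.∣ i ∣ ℤ.* + suc d      ∎

<⇒0<- : ∀ {p q} → p < q → 0ℚ < q - p
<⇒0<- {p} {q} p<q = subst (_< q - p) (+-inverseʳ p) (+-monoˡ-< (- p) p<q)

0<-⇒< : ∀ {p q} → 0ℚ < q - p → p < q
0<-⇒< {p} {q} h = subst₂ _<_ (+-identityʳ p) (solve 2 (λ p q → p :+ (q :- p) := q) refl p q) (+-monoʳ-< p h)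

≤⇒0≤- : ∀ {p q} → p ≤ q → 0ℚ ≤ q - p
≤⇒0≤- {p} {q} p≤q = subst (_≤ q - p) (+-inverseʳ p) (+-monoˡ-≤ (- p) p≤q)

0≤-⇒≤ : ∀ {p q} → 0ℚ ≤ q - p → p ≤ q
0≤-⇒≤ {p} {q} h = subst₂ _≤_ (+-identityʳ p) (solve 2 (λ p q → p :+ (q :- p) := q) refl p q) (+-monoʳ-≤ p h)

0<+ : ∀ {p q} → 0ℚ < p → 0ℚ < q → 0ℚ < p + q
0<+ = +-mono-<

0≤+ : ∀ {p q} → 0ℚ ≤ p → 0ℚ ≤ q → 0ℚ ≤ p + q
0≤+ = +-mono-≤

0<* : ∀ {p q} → 0ℚ < p → 0ℚ < q → 0ℚ < p * q
0<* {p} {q} 0<p 0<q = positive⁻¹ (p * q) {{pos*pos⇒pos p {{positive 0<p}} q {{positive 0<q}}}}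

0≤* : ∀ {p q} → 0ℚ ≤ p → 0ℚ ≤ q → 0ℚ ≤ p * q
0≤* {p} {q} 0≤p 0≤q = nonNegative⁻¹ (p * q) {{nonNeg*nonNeg⇒nonNeg p {{nonNegative 0≤p}} q {{nonNegative 0≤q}}}}

0≤x² : ∀ p → 0ℚ ≤ p * p
0≤x² p with ≤-total 0ℚ p
... | inj₁ 0≤p = 0≤* 0≤p 0≤p
... | inj₂ p≤0 = subst (0ℚ ≤_) (solve 1 (λ p → (:- p) :* (:- p) := p :* p) refl p)
                   (0≤* (neg-antimono-≤ p≤0) (neg-antimono-≤ p≤0))

mul-mono-≤ : ∀ {p q r s} → 0ℚ ≤ q → 0ℚ ≤ r → p ≤ q → r ≤ s → p * r ≤ q * s
mul-mono-≤ {p} {q} {r} {s} 0≤q 0≤r p≤q r≤s = 0≤-⇒≤ (subst (0ℚ ≤_)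
  (solve 4 (λ p q r s → q :* (s :- r) :+ r :* (q :- p) := q :* s :- p :* r) refl p q r s)
  (0≤+ (0≤* 0≤q (≤⇒0≤- r≤s)) (0≤* 0≤r (≤⇒0≤- p≤q))))

mul-monoˡ-< : ∀ {p q r} → 0ℚ < r → p < q → r * p < r * q
mul-monoˡ-< {r = r} 0<r = *-monoʳ-<-pos r {{positive 0<r}}

reciprocal : ∀ {p} → 0ℚ < p → ∃ λ r → 0ℚ < r × p * r ≡ 1ℚ
reciprocal {p} 0<p = (1/ p) {{nz}} , positive⁻¹ _ {{1/pos⇒pos p {{positive 0<p}}}} , *-inverseʳ p {{nz}}
  where nz = >-nonZero 0<p

small : ∀ y {ε} → 0ℚ < ε → ∃ λ K → ∀ k → K ℕ.≤ k → y * inv k < ε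
small y {ε} 0<ε with reciprocal 0<ε
... | e , 0<e , εe≡1 with archimedean (y * e)
...   | K , ye<K = K , λ k K≤k → 0<-⇒< (subst (0ℚ <_)
          (begin
            ε * inv k * (ι (suc k) - y * e)
              ≡⟨ solve 5 (λ ε t n y e → ε :* t :* (n :- y :* e) := ε :* (n :* t) :- y :* t :* (ε :* e)) refl ε (inv k) (ι (suc k)) y e ⟩
            ε * (ι (suc k) * inv k) - y * inv k * (ε * e)
              ≡⟨ cong₂ (λ u v → ε * u - y * inv k * v) (ι-inv k) εe≡1 ⟩
            ε * 1ℚ - y * inv k * 1ℚ
              ≡⟨ cong₂ _-_ (*-identityʳ ε) (*-identityʳ (y * inv k)) ⟩
            ε - y * inv k ∎)
          (0<* (0<* 0<ε (0<inv k)) (<⇒0<- (<-≤-trans ye<K (ι-mono (ℕ.s≤s K≤k))))))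
  where open ≡-Reasoning

shrink : ∀ {s p} → 0ℚ < s → s < p → ∃ λ z → 0ℚ < z × z < 1ℚ × s < p * z
shrink {s} {p} 0<s s<p with <-dense s<p | reciprocal (<-trans 0<s s<p)
... | m , s<m , m<p | r , 0<r , pr≡1 =
  r * m , 0<* 0<r (<-trans 0<s s<m) ,
  subst (r * m <_) (trans (*-comm r p) pr≡1) (mul-monoˡ-< 0<r m<p) ,
  subst (s <_) (sym (trans (sym (*-assoc p r m)) (trans (cong (_* m) pr≡1) (*-identityˡ m)))) s<m

^-pos : ∀ {a} n → 0ℚ < a → 0ℚ < a ^ n
^-pos zero    0<a = positive⁻¹ 1ℚ
^-pos (suc n) 0<a = 0<* 0<a (^-pos n 0<a)

^-mono : ∀ {a b} n → 0ℚ < a → a ≤ b → a ^ n ≤ b ^ n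
^-mono zero    0<a a≤b = ≤-refl
^-mono (suc n) 0<a a≤b =
  mul-mono-≤ (≤-trans (<⇒≤ 0<a) a≤b) (<⇒≤ (^-pos n 0<a)) a≤b (^-mono n 0<a a≤b)

bernoulli : ∀ n {x} → 0ℚ ≤ 1ℚ + x → 1ℚ + ι n * x ≤ (1ℚ + x) ^ n
bernoulli zero    {x} 0≤1+x = ≤-reflexive (solve 1 (λ x → con 1ℚ :+ con 0ℚ :* x := con 1ℚ) refl x)
bernoulli (suc n) {x} 0≤1+x = 0≤-⇒≤ (subst (0ℚ ≤_)
  (begin
    (1ℚ + x) * (E - (1ℚ + ι n * x)) + ι n * (x * x)
      ≡⟨ solve 3 (λ x e n → (con 1ℚ :+ x) :* (e :- (con 1ℚ :+ n :* x)) :+ n :* (x :* x)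
           := (con 1ℚ :+ x) :* e :- (con 1ℚ :+ (con 1ℚ :+ n) :* x)) refl x E (ι n) ⟩
    (1ℚ + x) * E - (1ℚ + (1ℚ + ι n) * x)
      ≡⟨ cong (λ u → (1ℚ + x) * E - (1ℚ + u * x)) (sym (ι-suc n)) ⟩
    (1ℚ + x) * E - (1ℚ + ι (suc n) * x) ∎)
  (0≤+ (0≤* 0≤1+x (≤⇒0≤- (bernoulli n 0≤1+x))) (0≤* (0≤ι n) (0≤x² x))))
  where
  open ≡-Reasoning
  E = (1ℚ + x) ^ n

-- (1 + q / (k + 1)) ^ (k + 1)
compound : ℚ → ℕ → ℚ
compound q k = (1ℚ + q * inv k) ^ suc k

ι-cancel-inv : ∀ y k → ι (suc k) * (y * inv k) ≡ y
ι-cancel-inv y k = trans (solve 3 (λ n y t → n :* (y :* t) := y :* (n :* t)) refl (ι (suc k)) y (inv k))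
                   (trans (cong (y *_) (ι-inv k)) (*-identityʳ y))

compound-≥ : ∀ y k → 0ℚ < 1ℚ + y → 0ℚ < 1ℚ + y * inv k × 1ℚ + y ≤ compound y k
compound-≥ y k 0<1+y =
  base>0 , subst (λ u → 1ℚ + u ≤ compound y k) (ι-cancel-inv y k) (bernoulli (suc k) (<⇒≤ base>0))
  where
  open ≡-Reasoning
  base>0 : 0ℚ < 1ℚ + y * inv k
  base>0 = subst (0ℚ <_)
    (begin
      inv k * (ι k + (1ℚ + y))
        ≡⟨ solve 4 (λ t n o y → t :* (n :+ (o :+ y)) := (o :+ n) :* t :+ y :* t) refl (inv k) (ι k) 1ℚ y ⟩
      (1ℚ + ι k) * inv k + y * inv k
        ≡⟨ cong (λ u → u * inv k + y * inv k) (sym (ι-suc k)) ⟩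
      ι (suc k) * inv k + y * inv k
        ≡⟨ cong (_+ y * inv k) (ι-inv k) ⟩
      1ℚ + y * inv k ∎)
    (0<* (0<inv k) (+-mono-≤-< (0≤ι k) 0<1+y))

compound-mono : ∀ {p q} k → p ≤ q → 0ℚ < 1ℚ + p * inv k →
                0ℚ < 1ℚ + q * inv k × compound p k ≤ compound q k
compound-mono {p} {q} k p≤q 0<1+p = <-≤-trans 0<1+p base , ^-mono (suc k) 0<1+p base
  where
  base : 1ℚ + p * inv k ≤ 1ℚ + q * inv k
  base = +-monoʳ-≤ 1ℚ (*-monoʳ-≤-nonNeg (inv k) {{nonNegative (<⇒≤ (0<inv k))}} p≤q)

bracket : ∀ {q r} j k → q ≤ r → 0ℚ < 1ℚ + q * inv j → 0ℚ < 1ℚ + - r * inv k →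
          compound q j * compound (- r) k ≤ 1ℚ
bracket {q} {r} j k q≤r 0<a 0<b = begin
  compound q j * compound (- r) k
    ≤⟨ mul-mono-≤ {compound q j} {(A ^ suc k) ^ suc j} {compound (- r) k} {(B ^ suc j) ^ suc k}
                (<⇒≤ (^-pos (suc j) (^-pos (suc k) 0<A))) (<⇒≤ (^-pos (suc k) 0<b))
                (^-mono (suc j) 0<a a≤A) (^-mono (suc k) 0<b b≤B) ⟩
  (A ^ suc k) ^ suc j * (B ^ suc j) ^ suc k
    ≡⟨ cong₂ _*_ (trans (^-assocʳ A (suc k) (suc j)) (cong (A ^_) (ℕ.*-comm (suc k) (suc j)))) (^-assocʳ B (suc j) (suc k)) ⟩
  A ^ N * B ^ N
    ≡⟨ sym (^-distrib-* A B N) ⟩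
  (A * B) ^ N
    ≤⟨ ^-mono N (0<* {A} {B} 0<A 0<B) AB≤1 ⟩
  1ℚ ^ N
    ≡⟨ 1^ N ⟩
  1ℚ ∎
  where
  open ≤-Reasoning
  N = suc j ℕ.* suc k
  A = 1ℚ + q * inv j * inv k
  B = 1ℚ + - r * inv k * inv j
  0<A : 0ℚ < A
  0<A = proj₁ (compound-≥ (q * inv j) k 0<a)
  0<B : 0ℚ < B
  0<B = proj₁ (compound-≥ (- r * inv k) j 0<b)
  a≤A : 1ℚ + q * inv j ≤ A ^ suc k
  a≤A = proj₂ (compound-≥ (q * inv j) k 0<a)
  b≤B : 1ℚ + - r * inv k ≤ B ^ suc j
  b≤B = proj₂ (compound-≥ (- r * inv k) j 0<b)
  1^ : ∀ n → 1ℚ ^ n ≡ 1ℚ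
  1^ zero    = refl
  1^ (suc n) = trans (*-identityˡ (1ℚ ^ n)) (1^ n)
  AB≤1 : A * B ≤ 1ℚ
  AB≤1 = 0≤-⇒≤ (core (inv j) (inv k) (<⇒≤ (0<inv j)) (<⇒≤ (0<inv k)) (<⇒≤ 0<B))
    where
    core : ∀ s t → 0ℚ ≤ s → 0ℚ ≤ t → 0ℚ ≤ 1ℚ + - r * t * s →
           0ℚ ≤ 1ℚ - (1ℚ + q * s * t) * (1ℚ + - r * t * s)
    core s t 0≤s 0≤t 0≤B = subst (0ℚ ≤_)
      (solve 4 (λ q r s t →
          (r :- q) :* (s :* t) :* (con 1ℚ :+ (:- r) :* t :* s) :+ (r :* t :* s) :* (r :* t :* s)
          := con 1ℚ :- (con 1ℚ :+ q :* s :* t) :* (con 1ℚ :+ (:- r) :* t :* s))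
        refl q r s t)
      (0≤+ (0≤* (0≤* (≤⇒0≤- q≤r) (0≤* 0≤s 0≤t)) 0≤B) (0≤x² (r * t * s)))

gap : ∀ q r m → 0ℚ < 1ℚ + q * inv m → 0ℚ < 1ℚ + - r * inv m →
      1ℚ + (q - r - q * r * inv m) ≤ compound q m * compound (- r) m
gap q r m 0<a 0<b = begin
  1ℚ + y                                  ≡⟨ cong (λ u → 1ℚ + u) (sym (ι-cancel-inv y m)) ⟩
  1ℚ + ι (suc m) * (y * inv m)            ≤⟨ bernoulli (suc m) (subst (0ℚ ≤_) eq (<⇒≤ (0<* 0<a 0<b))) ⟩
  (1ℚ + y * inv m) ^ suc m                ≡⟨ cong (_^ suc m) (sym eq) ⟩
  ((1ℚ + q * inv m) * (1ℚ + - r * inv m)) ^ suc m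
                                          ≡⟨ ^-distrib-* (1ℚ + q * inv m) (1ℚ + - r * inv m) (suc m) ⟩
  compound q m * compound (- r) m ∎
  where
  open ≤-Reasoning
  y = q - r - q * r * inv m
  eq : (1ℚ + q * inv m) * (1ℚ + - r * inv m) ≡ 1ℚ + y * inv m
  eq = solve 3 (λ q r t → (con 1ℚ :+ q :* t) :* (con 1ℚ :+ (:- r) :* t)
         := con 1ℚ :+ (q :- r :- q :* r :* t) :* t) refl q r (inv m)

loosen : ∀ {c s q} k → 0ℚ < c → 0ℚ < s → 0ℚ < 1ℚ + q * inv k → s < c * compound q k →
         ∃ λ q′ → q′ < q × 0ℚ < 1ℚ + q′ * inv k × s < c * compound q′ k
loosen {c} {s} {q} k 0<c 0<s 0<a s<cE = core (inv k) (λ y → compound-≥ y k) 0<a s<cE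
  where
  n = suc k
  core : ∀ t → (∀ y → 0ℚ < 1ℚ + y → 0ℚ < 1ℚ + y * t × 1ℚ + y ≤ (1ℚ + y * t) ^ n) →
         0ℚ < 1ℚ + q * t → s < c * (1ℚ + q * t) ^ n →
         ∃ λ q′ → q′ < q × 0ℚ < 1ℚ + q′ * t × s < c * (1ℚ + q′ * t) ^ n
  core t bern 0<a s<cE with shrink 0<s s<cE
  ... | z , 0<z , z<1 , s<cEz =
    q - (1ℚ - z) * (1ℚ + q * t) ,
    0<-⇒< (subst (0ℚ <_)
      (solve 3 (λ q z a → (con 1ℚ :- z) :* a := q :- (q :- (con 1ℚ :- z) :* a)) refl q z (1ℚ + q * t))
      (0<* (<⇒0<- z<1) 0<a)) ,
    subst (0ℚ <_) (ab≡ t z) (0<* 0<a (proj₁ step)) ,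
    <-≤-trans s<cEz (subst₂ _≤_ (sym (*-assoc c ((1ℚ + q * t) ^ n) z)) (cong (c *_) E≡)
      (*-monoˡ-≤-nonNeg c {{nonNegative (<⇒≤ 0<c)}}
        (*-monoˡ-≤-nonNeg ((1ℚ + q * t) ^ n) {{nonNegative (<⇒≤ (^-pos n 0<a))}} (proj₂ step))))
    where
    step : 0ℚ < 1ℚ + (z - 1ℚ) * t × z ≤ (1ℚ + (z - 1ℚ) * t) ^ n
    step = subst (λ u → 0ℚ < 1ℚ + (z - 1ℚ) * t × u ≤ (1ℚ + (z - 1ℚ) * t) ^ n) (sym (z≡ z))
             (bern (z - 1ℚ) (subst (0ℚ <_) (z≡ z) 0<z))
      where
      z≡ : ∀ z → z ≡ 1ℚ + (z - 1ℚ)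
      z≡ = solve 1 (λ z → z := con 1ℚ :+ (z :- con 1ℚ)) refl
    ab≡ : ∀ t z → (1ℚ + q * t) * (1ℚ + (z - 1ℚ) * t) ≡ 1ℚ + (q - (1ℚ - z) * (1ℚ + q * t)) * t
    ab≡ = solve 3 (λ q t z → (con 1ℚ :+ q :* t) :* (con 1ℚ :+ (z :- con 1ℚ) :* t)
            := con 1ℚ :+ (q :- (con 1ℚ :- z) :* (con 1ℚ :+ q :* t)) :* t) refl q
    E≡ : (1ℚ + q * t) ^ n * (1ℚ + (z - 1ℚ) * t) ^ n ≡ (1ℚ + (q - (1ℚ - z) * (1ℚ + q * t)) * t) ^ n
    E≡ = trans (sym (^-distrib-* (1ℚ + q * t) (1ℚ + (z - 1ℚ) * t) n)) (cong (_^ n) (ab≡ t z))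

-- Dedekind cuts: below q and above q say that q is less, respectively greater,
-- than the real number.
record ℝ : Set₁ where
  field
    below above : Pred ℚ 0ℓ
    below-inhabited : ∃ below
    above-inhabited : ∃ above
    below-down : ∀ {q r} → q < r → below r → below q
    above-up   : ∀ {q r} → q < r → above q → above r
    below-open : ∀ {q} → below q → ∃ λ r → q < r × below r
    above-open : ∀ {r} → above r → ∃ λ q → q < r × above q
    disjoint   : ∀ {q} → below q → above q → ⊥
    located    : ∀ {q r} → q < r → below q ⊎ above r

open ℝ

below<above : ∀ x {q r} → below x q → above x r → q < r
below<above x {q} {r} bq ar with <-cmp q r
... | tri< q<r _ _ = q<r
... | tri≈ _ refl _ = ⊥-elim (disjoint x bq ar)
... | tri> _ _ r<q = ⊥-elim (disjoint x (below-down x r<q bq) ar)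

approximate : ∀ x {ε} → 0ℚ < ε → ∃₂ λ q r → below x q × above x r × r - q < ε
approximate x {ε} 0<ε with <-dense 0<ε
... | δ , 0<δ , δ<ε =
  refine (½ * δ) (0<* (positive⁻¹ ½) 0<δ)
    (λ c → subst (_< ε) (solve 2 (λ c d → d := c :+ con ½ :* d :+ con ½ :* d :- c) refl c δ) δ<ε)
  where
  refine : ∀ η → 0ℚ < η → (∀ c → c + η + η - c < ε) → ∃₂ λ q r → below x q × above x r × r - q < ε
  refine η 0<η 2η<ε with below-inhabited x | above-inhabited x | reciprocal 0<η
  ... | a , ba | b , ab | e , 0<e , ηe≡1 with archimedean ((b - a) * e)
  ...   | N , lt = walk (suc N) a ba (above-up x (far (ι (suc N)) lt) ab)
    where
    far : ∀ n → (b - a) * e < n → b < a + n * η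
    far n lt = 0<-⇒< (subst (0ℚ <_)
      (trans (solve 5 (λ a b n h e → h :* (n :- (b :- a) :* e) := n :* h :- (b :- a) :* (h :* e)) refl a b n η e)
      (trans (cong (λ u → n * η - (b - a) * u) ηe≡1)
             (solve 4 (λ a b n h → n :* h :- (b :- a) :* con 1ℚ := a :+ n :* h :- b) refl a b n η)))
      (0<* 0<η (<⇒0<- lt)))
    +η : ∀ c → c < c + η
    +η c = subst (_< c + η) (+-identityʳ c) (+-monoʳ-< c 0<η)
    walk : ∀ n c → below x c → above x (c + ι n * η) → ∃₂ λ q r → below x q × above x r × r - q < ε
    walk zero    c bc ac = ⊥-elim (disjoint x bc
      (subst (above x) (solve 2 (λ c h → c :+ con 0ℚ :* h := c) refl c η) ac))
    walk (suc n) c bc ac with located x (+η (c + η))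
    ... | inj₁ b′ = walk n (c + η) b′ (subst (above x)
            (trans (cong (λ u → c + u * η) (ι-suc n)) (shift (ι n))) ac)
      where
      shift : ∀ m → c + (1ℚ + m) * η ≡ c + η + m * η
      shift m = solve 3 (λ c n h → c :+ (con 1ℚ :+ n) :* h := c :+ h :+ n :* h) refl c m η
    ... | inj₂ a′ = c , c + η + η , bc , a′ , 2η<ε c

fromℚ : ℚ → ℝ
fromℚ p = record
  { below = _< p
  ; above = p <_
  ; below-inhabited = p - 1ℚ , subst (p - 1ℚ <_) (+-identityʳ p) (+-monoʳ-< p (negative⁻¹ (- 1ℚ)))
  ; above-inhabited = p + 1ℚ , subst (_< p + 1ℚ) (+-identityʳ p) (+-monoʳ-< p (positive⁻¹ 1ℚ))
  ; below-down = <-trans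
  ; above-up   = λ q<r p<q → <-trans p<q q<r
  ; below-open = <-dense
  ; above-open = λ p<r → let m , p<m , m<r = <-dense p<r in m , m<r , p<m
  ; disjoint   = λ q<p p<q → <-asym q<p p<q
  ; located    = loc
  }
  where
  loc : ∀ {q r} → q < r → q < p ⊎ p < r
  loc {q} q<r with q <? p
  ... | yes q<p = inj₁ q<p
  ... | no  q≮p = inj₂ (≤-<-trans (≮⇒≥ q≮p) q<r)

infix 4 _≤ᵣ_
_≤ᵣ_ : ℝ → ℝ → Set
x ≤ᵣ y = ∀ {q} → below x q → below y q

infixl 6 _+ᵣ_
_+ᵣ_ : ℝ → ℚ → ℝ
x +ᵣ p = record
  { below = λ q → below x (q - p)
  ; above = λ q → above x (q - p)
  ; below-inhabited = let q , b = below-inhabited x in q + p , subst (below x) (back q) b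
  ; above-inhabited = let q , b = above-inhabited x in q + p , subst (above x) (back q) b
  ; below-down = λ q<r → below-down x (+-monoˡ-< (- p) q<r)
  ; above-up   = λ q<r → above-up x (+-monoˡ-< (- p) q<r)
  ; below-open = λ {q} b → let r , lt , b′ = below-open x b in
      r + p , subst (_< r + p) (sym (forth q)) (+-monoˡ-< p lt) , subst (below x) (back r) b′
  ; above-open = λ {r} a → let q , lt , a′ = above-open x a in
      q + p , subst (q + p <_) (sym (forth r)) (+-monoˡ-< p lt) , subst (above x) (back q) a′
  ; disjoint = disjoint x
  ; located  = λ q<r → located x (+-monoˡ-< (- p) q<r)
  }
  where
  back : ∀ q → q ≡ q + p - p
  back q = solve 2 (λ q p → q := q :+ p :- p) refl q p
  forth : ∀ q → q ≡ q - p + p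
  forth q = solve 2 (λ q p → q := q :- p :+ p) refl q p

infixl 7 _/ᵣ_
_/ᵣ_ : ℝ → (n : ℕ) .{{_ : ℕ.NonZero n}} → ℝ
x /ᵣ suc k = record
  { below = λ q → below x (ι (suc k) * q)
  ; above = λ q → above x (ι (suc k) * q)
  ; below-inhabited = let q , b = below-inhabited x in q * inv k , subst (below x) (sym (ι-cancel-inv q k)) b
  ; above-inhabited = let q , b = above-inhabited x in q * inv k , subst (above x) (sym (ι-cancel-inv q k)) b
  ; below-down = λ q<r → below-down x (up q<r)
  ; above-up   = λ q<r → above-up x (up q<r)
  ; below-open = λ {q} b → let r , lt , b′ = below-open x b in
      r * inv k , subst (_< r * inv k) (back q) (down lt) , subst (below x) (sym (ι-cancel-inv r k)) b′
  ; above-open = λ {r} a → let q , lt , a′ = above-open x a in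
      q * inv k , subst (q * inv k <_) (back r) (down lt) , subst (above x) (sym (ι-cancel-inv q k)) a′
  ; disjoint = disjoint x
  ; located  = λ q<r → located x (up q<r)
  }
  where
  back : ∀ q → ι (suc k) * q * inv k ≡ q
  back q = trans (*-assoc (ι (suc k)) q (inv k)) (ι-cancel-inv q k)
  down : ∀ {q r} → q < r → q * inv k < r * inv k
  down = *-monoˡ-<-pos (inv k) {{positive (0<inv k)}}
  up : ∀ {q r} → q < r → ι (suc k) * q < ι (suc k) * r
  up = mul-monoˡ-< (0<ι-suc k)

-- For large n, (1 + q / n) ^ n increases to the exponential of q and
-- (1 - q / n) ^ (- n) decreases to it; both monotonicity statements only
-- need the base to be positive.  Hence r <exp q and q exp< r say that the
-- exponential of q is greater, respectively less, than r.
_<exp_ : ℚ → ℚ → Set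
r <exp q = ∃ λ k → 0ℚ < 1ℚ + q * inv k × r < compound q k

_exp<_ : ℚ → ℚ → Set
q exp< r = ∃ λ k → 0ℚ < 1ℚ + - q * inv k × 1ℚ < r * compound (- q) k


scale-≤ : ∀ r p q → 0ℚ < r → p ≤ q → r * p ≤ r * q
scale-≤ r p q 0<r p≤q = *-monoˡ-≤-nonNeg r {{nonNegative (<⇒≤ 0<r)}} p≤q

scale-< : ∀ r p q → 0ℚ < r → p < q → r * p < r * q
scale-< r p q = mul-monoˡ-< {p} {q} {r}

exp-below<above : ∀ {q r s t} → q ≤ r → s <exp q → r exp< t → s < t
exp-below<above {q} {r} {s} {t} q≤r (j , 0<a , s<A) (k , 0<b , 1<tB) =
  core (compound q j) (compound (- r) k) (^-pos (suc k) 0<b) s<A 1<tB (bracket j k q≤r 0<a 0<b)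
  where
  core : ∀ A B → 0ℚ < B → s < A → 1ℚ < t * B → A * B ≤ 1ℚ → s < t
  core A B 0<B s<A 1<tB AB≤1 = *-cancelʳ-<-nonNeg B {{nonNegative (<⇒≤ 0<B)}}
    (<-trans (*-monoˡ-<-pos B {{positive 0<B}} s<A) (≤-<-trans AB≤1 1<tB))

<exp-mono : ∀ {q r s} → q ≤ r → s <exp q → s <exp r
<exp-mono {q} {r} q≤r (k , 0<a , s<A) =
  let 0<a′ , A≤A′ = compound-mono {q} {r} k q≤r 0<a in k , 0<a′ , <-≤-trans s<A A≤A′

exp<-anti : ∀ {q r s} → 0ℚ < s → q ≤ r → r exp< s → q exp< s
exp<-anti {q} {r} {s} 0<s q≤r (k , 0<b , 1<sB) =
  k , proj₁ step , <-≤-trans 1<sB (scale-≤ s (compound (- r) k) (compound (- q) k) 0<s (proj₂ step))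
  where
  step : 0ℚ < 1ℚ + - q * inv k × compound (- r) k ≤ compound (- q) k
  step = compound-mono { - r} { - q} k (neg-antimono-≤ {q} {r} q≤r) 0<b

guard-core : ∀ q t → - q * t < 1ℚ → 0ℚ < 1ℚ + q * t
guard-core q t lt = subst (0ℚ <_) (eq q t) (<⇒0<- lt)
  where
  eq : ∀ q t → 1ℚ - (- q) * t ≡ 1ℚ + q * t
  eq = solve 2 (λ q t → con 1ℚ :- (:- q) :* t := con 1ℚ :+ q :* t) refl

guard : ∀ q → ∃ λ K → ∀ k → K ℕ.≤ k → 0ℚ < 1ℚ + q * inv k
guard q = let K , f = small (- q) {1ℚ} (positive⁻¹ 1ℚ) in K , λ k K≤k → guard-core q (inv k) (f k K≤k)

0<exp : ∀ q → 0ℚ <exp q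
0<exp q = let K , f = guard q ; 0<a = f K ℕ.≤-refl in K , 0<a , ^-pos (suc K) 0<a

exp<-inhabited : ∀ q → ∃ λ r → q exp< r
exp<-inhabited q =
  let K , f = guard (- q)
      0<b = f K ℕ.≤-refl
      r , 1<rB = core (compound (- q) K) (^-pos (suc K) 0<b)
  in r , K , 0<b , 1<rB
  where
  core : ∀ B → 0ℚ < B → ∃ λ r → 1ℚ < r * B
  core B 0<B with reciprocal 0<B
  ... | r , 0<r , Br≡1 = r + r , subst (1ℚ <_) eq (+-monoʳ-< 1ℚ (positive⁻¹ 1ℚ))
    where
    eq : 1ℚ + 1ℚ ≡ (r + r) * B
    eq = trans (cong₂ _+_ (sym Br≡1) (sym Br≡1)) (solve 2 (λ B r → B :* r :+ B :* r := (r :+ r) :* B) refl B r)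

exp<⇒0< : ∀ {q r} → q exp< r → 0ℚ < r
exp<⇒0< {q} {r} h = exp-below<above {q} {q} {0ℚ} {r} ≤-refl (0<exp q) h

exp<-open : ∀ {q r} → q exp< r → ∃ λ s → s < r × q exp< s
exp<-open {q} {r} h@(k , 0<b , 1<rB) =
  let s , s<r , 1<sB = core (compound (- q) k) 1<rB in s , s<r , k , 0<b , 1<sB
  where
  0<r : 0ℚ < r
  0<r = exp<⇒0< {q} {r} h
  core : ∀ B → 1ℚ < r * B → ∃ λ s → s < r × 1ℚ < s * B
  core B 1<rB with shrink {1ℚ} (positive⁻¹ 1ℚ) 1<rB
  ... | z , 0<z , z<1 , lt = r * z , subst (r * z <_) (*-identityʳ r) (mul-monoˡ-< 0<r z<1) ,
    subst (1ℚ <_) (solve 3 (λ r B z → r :* B :* z := r :* z :* B) refl r B z) lt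

neg² : ∀ p → - - p ≡ p
neg² = solve 1 (λ p → :- (:- p) := p) refl

exp<-openʳ : ∀ {q r} → q exp< r → ∃ λ s → q < s × s exp< r
exp<-openʳ {q} {r} h@(k , 0<b , 1<rB) =
  let p , p<-q , 0<b′ , 1<rB′ = loosen {r} {1ℚ} { - q} k (exp<⇒0< {q} {r} h) (positive⁻¹ 1ℚ) 0<b 1<rB in
  - p , subst (_< - p) (neg² q) (neg-antimono-< {p} { - q} p<-q) , k ,
  subst (λ u → 0ℚ < 1ℚ + u * inv k) (sym (neg² p)) 0<b′ ,
  subst (λ u → 1ℚ < r * compound u k) (sym (neg² p)) 1<rB′

<exp-openˡ : ∀ {q r} → 0ℚ < r → r <exp q → ∃ λ s → s < q × r <exp s
<exp-openˡ {q} {r} 0<r (k , 0<a , r<A) =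
  let s , s<q , 0<a′ , r<A′ = loosen {1ℚ} {r} {q} k (positive⁻¹ 1ℚ) 0<r 0<a
                                (subst (r <_) (sym (*-identityˡ (compound q k))) r<A) in
  s , s<q , k , 0<a′ , subst (r <_) (*-identityˡ (compound s k)) r<A′

wide : ∀ q r {c} → c < 1ℚ + (q - r) →
       ∃ λ k → 0ℚ < 1ℚ + q * inv k × 0ℚ < 1ℚ + - r * inv k × c < compound q k * compound (- r) k
wide q r {c} c< =
  let K₁ , f = guard q
      K₂ , g = guard (- r)
      K₃ , h = small (q * r) {1ℚ + (q - r) - c} (<⇒0<- {c} {1ℚ + (q - r)} c<)
      k = K₁ ℕ.+ (K₂ ℕ.+ K₃)
      0<a = f k (ℕ.m≤m+n K₁ (K₂ ℕ.+ K₃))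
      0<b = g k (ℕ.≤-trans (ℕ.m≤m+n K₂ K₃) (ℕ.m≤n+m (K₂ ℕ.+ K₃) K₁))
      lt = h k (ℕ.≤-trans (ℕ.m≤n+m K₃ K₂) (ℕ.m≤n+m (K₂ ℕ.+ K₃) K₁))
  in k , 0<a , 0<b , <-≤-trans (core (inv k) lt) (gap q r k 0<a 0<b)
  where
  core : ∀ t → q * r * t < 1ℚ + (q - r) - c → c < 1ℚ + (q - r - q * r * t)
  core t lt = 0<-⇒< (subst (0ℚ <_) (eq t) (<⇒0<- lt))
    where
    eq : ∀ t → 1ℚ + (q - r) - c - q * r * t ≡ 1ℚ + (q - r - q * r * t) - c
    eq = solve 4 (λ q r c t → con 1ℚ :+ (q :- r) :- c :- q :* r :* t
           := con 1ℚ :+ (q :- r :- q :* r :* t) :- c) refl q r c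

exp-located : ∀ {q r s t} → 0ℚ < s → 0ℚ < t → s < t * (1ℚ + (q - r)) → s <exp q ⊎ r exp< t
exp-located {q} {r} {s} {t} 0<s 0<t s<t = from (reciprocal 0<t)
  where
  decide : ∀ e → 0ℚ < e → t * e ≡ 1ℚ → ∀ A B → 0ℚ < B → s * e < A * B → s < A ⊎ 1ℚ < t * B
  decide e 0<e te≡1 A B 0<B lt with s <? A
  ... | yes s<A = inj₁ s<A
  ... | no  s≮A = inj₂ (*-cancelʳ-<-nonNeg (s * e) {{nonNegative (<⇒≤ (0<* 0<s 0<e))}} (begin-strict
    1ℚ * (s * e)    ≡⟨ *-identityˡ (s * e) ⟩
    s * e           <⟨ lt ⟩
    A * B           ≤⟨ *-monoʳ-≤-nonNeg B {{nonNegative (<⇒≤ 0<B)}} (≮⇒≥ s≮A) ⟩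
    s * B           ≡⟨ *-identityʳ (s * B) ⟨
    s * B * 1ℚ      ≡⟨ cong (s * B *_) te≡1 ⟨
    s * B * (t * e) ≡⟨ solve 4 (λ s e t B → s :* B :* (t :* e) := t :* B :* (s :* e)) refl s e t B ⟩
    t * B * (s * e) ∎))
    where open ≤-Reasoning
  c< : ∀ e → 0ℚ < e → t * e ≡ 1ℚ → ∀ u → s < t * u → s * e < u
  c< e 0<e te≡1 u s<tu = subst₂ _<_ (*-comm e s) eq (scale-< e s (t * u) 0<e s<tu)
    where
    eq : e * (t * u) ≡ u
    eq = trans (solve 3 (λ e t u → e :* (t :* u) := (t :* e) :* u) refl e t u)
               (trans (cong (_* u) te≡1) (*-identityˡ u))
  from : (∃ λ e → 0ℚ < e × t * e ≡ 1ℚ) → s <exp q ⊎ r exp< t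
  from (e , 0<e , te≡1) =
    let k , 0<a , 0<b , lt = wide q r {s * e} (c< e 0<e te≡1 (1ℚ + (q - r)) s<t) in
    Sum.map (λ s<A → k , 0<a , s<A) (λ 1<tB → k , 0<b , 1<tB)
      (decide e 0<e te≡1 (compound q k) (compound (- r) k) (^-pos (suc k) 0<b) lt)

-- The exponential of ℚ, extended to ℝ by monotonicity and continuity.
exp : ℝ → ℝ
exp x = record
  { below = λ r → ∃ λ q → below x q × r <exp q
  ; above = λ r → ∃ λ q → above x q × q exp< r
  ; below-inhabited = let q , bq = below-inhabited x in 0ℚ , q , bq , 0<exp q
  ; above-inhabited = let q , aq = above-inhabited x ; r , h = exp<-inhabited q in r , q , aq , h
  ; below-down = λ r<s (q , bq , k , 0<a , s<A) → q , bq , k , 0<a , <-trans r<s s<A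
  ; above-up   = λ r<s (q , aq , h) → q , aq , exp<-up {q} r<s h
  ; below-open = λ (q , bq , k , 0<a , r<A) →
      let m , r<m , m<A = <-dense r<A in m , r<m , q , bq , k , 0<a , m<A
  ; above-open = λ {r} (q , aq , h) → let s , s<r , h′ = exp<-open {q} {r} h in s , s<r , q , aq , h′
  ; disjoint = λ {s} (q , bq , l) (r , ar , u) →
      <-irrefl {s} refl (exp-below<above {q} {r} {s} {s} (<⇒≤ (below<above x bq ar)) l u)
  ; located = loc
  }
  where
  exp<-up : ∀ {q r s} → r < s → q exp< r → q exp< s
  exp<-up {q} r<s (k , 0<b , lt) =
    k , 0<b , <-trans lt (*-monoˡ-<-pos (compound (- q) k) {{positive (^-pos (suc k) 0<b)}} r<s)
  locPos : ∀ {s t} → 0ℚ < s → s < t → (∃ λ q → below x q × s <exp q) ⊎ (∃ λ q → above x q × q exp< t)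
  locPos {s} {t} 0<s s<t =
    let z , 0<z , z<1 , s<tz = shrink 0<s s<t
        q , r , bq , ar , δ< = approximate x {1ℚ - z} (<⇒0<- z<1)
    in Sum.map (λ l → q , bq , l) (λ u → r , ar , u)
         (exp-located {q} {r} {s} {t} 0<s 0<t (<-trans s<tz (scale-< t z (1ℚ + (q - r)) 0<t (z< q r z δ<))))
    where
    0<t : 0ℚ < t
    0<t = <-trans 0<s s<t
    z< : ∀ q r z → r - q < 1ℚ - z → z < 1ℚ + (q - r)
    z< q r z lt = 0<-⇒< (subst (0ℚ <_) (eq q r z) (<⇒0<- lt))
      where
      eq : ∀ q r z → 1ℚ - z - (r - q) ≡ 1ℚ + (q - r) - z
      eq = solve 3 (λ q r z → con 1ℚ :- z :- (r :- q) := con 1ℚ :+ (q :- r) :- z) refl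
  loc : ∀ {s t} → s < t → (∃ λ q → below x q × s <exp q) ⊎ (∃ λ q → above x q × q exp< t)
  loc {s} s<t with 0ℚ <? s
  ... | yes 0<s = locPos 0<s s<t
  ... | no  0≮s = let q , bq = below-inhabited x ; k , 0<a , 0<A = 0<exp q in
                  inj₁ (q , bq , k , 0<a , ≤-<-trans (≮⇒≥ 0≮s) 0<A)

-- The inverse function of exp.
logℚ : (y : ℚ) → 0ℚ < y → ℝ
logℚ y 0<y = record
  { below = _exp< y
  ; above = y <exp_
  ; below-inhabited = lower
  ; above-inhabited = y , 1+<exp y (<-trans 0<y (y<1+y y)) (y<1+y y)
  ; below-down = λ {q} {r} q<r → exp<-anti {q} {r} {y} 0<y (<⇒≤ q<r)
  ; above-up   = λ {q} {r} q<r → <exp-mono {q} {r} {y} (<⇒≤ q<r)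
  ; below-open = λ {q} → exp<-openʳ {q} {y}
  ; above-open = λ {q} → <exp-openˡ {q} {y} 0<y
  ; disjoint = λ {q} l u → <-irrefl {y} refl (exp-below<above {q} {q} {y} {y} ≤-refl u l)
  ; located = λ {q} {r} q<r → Sum.swap (exp-located {r} {q} {y} {y} 0<y 0<y
      (subst (_< y * (1ℚ + (r - q))) (*-identityʳ y) (scale-< y 1ℚ (1ℚ + (r - q)) 0<y (1<1+ (r - q) (<⇒0<- q<r)))))
  }
  where
  1<1+ : ∀ u → 0ℚ < u → 1ℚ < 1ℚ + u
  1<1+ u 0<u = subst (_< 1ℚ + u) (+-identityʳ 1ℚ) (+-monoʳ-< 1ℚ 0<u)
  y<1+y : ∀ u → u < 1ℚ + u
  y<1+y u = subst (_< 1ℚ + u) (+-identityˡ u) (+-monoˡ-< u (positive⁻¹ 1ℚ))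
  1+<exp : ∀ q {r} → 0ℚ < 1ℚ + q → r < 1ℚ + q → r <exp q
  1+<exp q 0<1+q r< = let 0<a , le = compound-≥ q 0 0<1+q in 0 , 0<a , <-≤-trans r< le
  lower : ∃ λ q → q exp< y
  lower = from (reciprocal 0<y)
    where
    1<y[1+e] : ∀ e → y * e ≡ 1ℚ → 1ℚ < y * (1ℚ + e)
    1<y[1+e] e ye≡1 = subst₂ _<_ (+-identityˡ 1ℚ) eq (+-monoˡ-< 1ℚ 0<y)
      where
      eq : y + 1ℚ ≡ y * (1ℚ + e)
      eq = trans (cong (λ u → y + u) (sym ye≡1)) (solve 2 (λ y e → y :+ y :* e := y :* (con 1ℚ :+ e)) refl y e)
    from : (∃ λ e → 0ℚ < e × y * e ≡ 1ℚ) → ∃ λ q → q exp< y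
    from (e , 0<e , ye≡1) = - e , 0 , proj₁ step ,
      <-≤-trans (1<y[1+e] e ye≡1) (scale-≤ y (1ℚ + e) (compound (- - e) 0) 0<y (proj₂ step))
      where
      step : 0ℚ < 1ℚ + - - e * inv 0 × 1ℚ + e ≤ compound (- - e) 0
      step = subst (λ u → 0ℚ < 1ℚ + u * inv 0 × 1ℚ + e ≤ compound u 0) (sym (neg² e))
               (compound-≥ e 0 (<-trans 0<e (y<1+y e)))

-- [x , x + dx] × [y , y + dy] × [z , z + 1]
record Box : Set where
  constructor box
  field
    x y z : ℤ
    dx dy : ℕ

open Box

IsBlock : ℕ → ℕ → Box → Set
IsBlock b w B = (dx B ≡ b × dy B ≡ w) ⊎ (dx B ≡ w × dy B ≡ b)

-- The unit square [i , i + 1] × [j , j + 1] lies in the projection of B.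
HasStud : Box → ℤ → ℤ → Set
HasStud B i j = (x B ℤ.≤ i × i ℤ.< x B ℤ.+ ℤ.+ dx B) × (y B ℤ.≤ j × j ℤ.< y B ℤ.+ ℤ.+ dy B)

-- As corners are integral, the projections overlap in a set with nonempty
-- interior exactly when they have a unit square in common.
ShareStud : Box → Box → Set
ShareStud A B = ∃₂ λ i j → HasStud A i j × HasStud B i j

InteriorsMeet : Box → Box → Set
InteriorsMeet A B = z A ≡ z B × ShareStud A B

Attached : Box → Box → Set
Attached A B = ℤ.∣ z A ℤ.- z B ∣ ≡ 1 × ShareStud A B

-- Blocks with different indices are distinct, since the interior of a block of
-- positive size meets itself; so a building is a set of exactly n blocks.
record Building (b w n : ℕ) : Set where
  field
    blocks     : Vector Box n
    isBlock    : ∀ i → IsBlock b w (blocks i)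
    disjoint   : ∀ i j → i ≢ j → ¬ InteriorsMeet (blocks i) (blocks j)
    contiguous : ∀ i j → Star (λ k l → Attached (blocks k) (blocks l)) i j

open Building using (blocks)

shift : ℤ × ℤ × ℤ → Box → Box
shift (a , b , c) (box x y z dx dy) = box (x ℤ.+ a) (y ℤ.+ b) (z ℤ.+ c) dx dy

-- (p , q , r) ↦ (- q , p , r)
turn : Box → Box
turn (box x y z dx dy) = box (ℤ.- (y ℤ.+ ℤ.+ dy)) x z dy dx

turns : ℕ → Box → Box
turns k B = fold B turn k

SameSet : ∀ {n} → Vector Box n → Vector Box n → Set
SameSet F G = (∀ i → ∃ λ j → F i ≡ G j) × (∀ j → ∃ λ i → F i ≡ G j)

-- A rotation about any vertical axis is a rotation about the z-axis followed
-- by a translation, so every composition of the allowed motions is a power of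
-- turn followed by a translation; it is integral if it maps a block to a block.
Identified : ∀ {b w n} → Building b w n → Building b w n → Set
Identified P Q = ∃₂ λ k t → SameSet (shift t ∘ turns k ∘ blocks P) (blocks Q)

turnVec : ℤ × ℤ × ℤ → ℤ × ℤ × ℤ
turnVec (a , b , c) = ℤ.- b , a , c

turnsVec : ℕ → ℤ × ℤ × ℤ → ℤ × ℤ × ℤ
turnsVec k t = fold t turnVec k

_⊕_ : ℤ × ℤ × ℤ → ℤ × ℤ × ℤ → ℤ × ℤ × ℤ
(a , b , c) ⊕ (a′ , b′ , c′) = a ℤ.+ a′ , b ℤ.+ b′ , c ℤ.+ c′

⊖_ : ℤ × ℤ × ℤ → ℤ × ℤ × ℤ
⊖ (a , b , c) = ℤ.- a , ℤ.- b , ℤ.- c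

corner : ∀ {x y z x′ y′ z′ dx dy} → x ≡ x′ → y ≡ y′ → z ≡ z′ → box x y z dx dy ≡ box x′ y′ z′ dx dy
corner refl refl refl = refl

shift-0 : ∀ B → shift (0ℤ , 0ℤ , 0ℤ) B ≡ B
shift-0 B = corner (ℤ.+-identityʳ _) (ℤ.+-identityʳ _) (ℤ.+-identityʳ _)

shift-⊕ : ∀ t u B → shift u (shift t B) ≡ shift (t ⊕ u) B
shift-⊕ t u B = corner (ℤ.+-assoc (x B) _ _) (ℤ.+-assoc (y B) _ _) (ℤ.+-assoc (z B) _ _)

+-neg-cancel : ∀ p q → p ℤ.+ q ℤ.+ ℤ.- q ≡ p
+-neg-cancel p q = trans (ℤ.+-assoc p q (ℤ.- q)) (trans (cong (λ u → p ℤ.+ u) (ℤ.+-inverseʳ q)) (ℤ.+-identityʳ p))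

shift-⊖ : ∀ t B → shift (⊖ t) (shift t B) ≡ B
shift-⊖ (a , b , c) B = corner (+-neg-cancel (x B) a) (+-neg-cancel (y B) b) (+-neg-cancel (z B) c)

turn-shift : ∀ t B → turn (shift t B) ≡ shift (turnVec t) (turn B)
turn-shift (a , b , c) B = corner
  (trans (cong (λ u → ℤ.- u) (swap (y B) b (ℤ.+ dy B))) (ℤ.neg-distrib-+ (y B ℤ.+ ℤ.+ dy B) b)) refl refl
  where
  swap : ∀ p q r → p ℤ.+ q ℤ.+ r ≡ p ℤ.+ r ℤ.+ q
  swap p q r = trans (ℤ.+-assoc p q r) (trans (cong (λ u → p ℤ.+ u) (ℤ.+-comm q r)) (sym (ℤ.+-assoc p r q)))

turns-shift : ∀ k t B → turns k (shift t B) ≡ shift (turnsVec k t) (turns k B)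
turns-shift zero    t B = refl
turns-shift (suc k) t B = trans (cong turn (turns-shift k t B)) (turn-shift (turnsVec k t) (turns k B))

turns-+ : ∀ k l B → turns (k ℕ.+ l) B ≡ turns k (turns l B)
turns-+ k l B = fold-+ B turn k

turn⁴ : ∀ B → turns 4 B ≡ B
turn⁴ B = corner (eq (x B) (ℤ.+ dx B)) (eq (y B) (ℤ.+ dy B)) refl
  where
  eq : ∀ p d → ℤ.- (ℤ.- (p ℤ.+ d) ℤ.+ d) ≡ p
  eq p d = trans (ℤ.neg-distrib-+ (ℤ.- (p ℤ.+ d)) d)
    (trans (cong (λ u → u ℤ.+ ℤ.- d) (ℤ.neg-involutive (p ℤ.+ d))) (+-neg-cancel p d))

turns-4* : ∀ k B → turns (k ℕ.* 4) B ≡ B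
turns-4* zero    B = refl
turns-4* (suc k) B = trans (turns-+ 4 (k ℕ.* 4) B) (trans (turn⁴ _) (turns-4* k B))

turns-inverse : ∀ k B → turns (k ℕ.* 3) (turns k B) ≡ B
turns-inverse k B = trans (sym (turns-+ (k ℕ.* 3) k B))
  (trans (cong (λ m → turns m B) (trans (ℕ.+-comm (k ℕ.* 3) k) (sym (ℕ.*-suc k 3)))) (turns-4* k B))

motion-inverse : ∀ k t B → shift (⊖ turnsVec (k ℕ.* 3) t) (turns (k ℕ.* 3) (shift t (turns k B))) ≡ B
motion-inverse k t B = trans
  (cong (shift (⊖ turnsVec (k ℕ.* 3) t))
    (trans (turns-shift (k ℕ.* 3) t (turns k B)) (cong (shift (turnsVec (k ℕ.* 3) t)) (turns-inverse k B))))
  (shift-⊖ (turnsVec (k ℕ.* 3) t) B)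

motion-∘ : ∀ k t l u B →
  shift u (turns l (shift t (turns k B))) ≡ shift (turnsVec l t ⊕ u) (turns (l ℕ.+ k) B)
motion-∘ k t l u B = trans
  (cong (shift u) (trans (turns-shift l t (turns k B)) (cong (shift (turnsVec l t)) (sym (turns-+ l k B)))))
  (shift-⊕ (turnsVec l t) u (turns (l ℕ.+ k) B))

buildings : ℕ → ℕ → ℕ → Setoid 0ℓ 0ℓ
buildings b w n = record
  { Carrier       = Building b w n
  ; _≈_           = Identified
  ; isEquivalence = record
    { refl  = 0 , (0ℤ , 0ℤ , 0ℤ) , (λ i → i , shift-0 _) , (λ i → i , shift-0 _)
    ; sym   = λ {P} {Q} (k , t , f , g) → k ℕ.* 3 , ⊖ turnsVec (k ℕ.* 3) t ,
        (λ j → let i , e = g j in i , back (blocks P i) k t e) ,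
        (λ i → let j , e = f i in j , back (blocks P i) k t e)
    ; trans = λ {P} {Q} {R} (k , t , f , g) (l , u , f′ , g′) → l ℕ.+ k , turnsVec l t ⊕ u ,
        (λ h → let i , e = f h ; j , e′ = f′ i in j , both (blocks P h) k t l u e e′) ,
        (λ j → let i , e′ = g′ j ; h , e = g i in h , both (blocks P h) k t l u e e′)
    }
  }
  where
  back : ∀ A {B} k t → shift t (turns k A) ≡ B → shift (⊖ turnsVec (k ℕ.* 3) t) (turns (k ℕ.* 3) B) ≡ A
  back A k t refl = motion-inverse k t A
  both : ∀ A {B C} k t l u → shift t (turns k A) ≡ B → shift u (turns l B) ≡ C →
         shift (turnsVec l t ⊕ u) (turns (l ℕ.+ k) A) ≡ C
  both A k t l u refl refl = sym (motion-∘ k t l u A)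

HasSize : Setoid 0ℓ 0ℓ → ℕ → Set
HasSize S k = Bijection (setoid (Fin k)) S

fromℕ : ℕ → ℝ
fromℕ n = fromℚ (ι n)

-- log 0 is a junk value.
log : ℕ → ℝ
log zero    = fromℕ 0
log (suc n) = logℚ (ι (suc n)) (0<ι-suc n)

ConvergesTo : ((n : ℕ) .{{_ : ℕ.NonZero n}} → ℝ) → ℝ → Set
ConvergesTo u s = ∀ {ε} → 0ℚ < ε → ∃ λ N → ∀ n .{{_ : ℕ.NonZero n}} → N ℕ.≤ n →
                  u n ≤ᵣ s +ᵣ ε × s ≤ᵣ u n +ᵣ ε

-- T n is the number of buildings with n blocks, and s the limit of log (T n) / n.
-- Every T n with n ≥ 1 is positive, so log 0 does not occur.
IsEntropy : ℕ → ℕ → ℝ → Set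
IsEntropy b w s = ∃ λ (T : ℕ → ℕ) →
  (∀ n → HasSize (buildings b w n) (T n)) × ConvergesTo (λ n → log (T n) /ᵣ n) s

-- x is at most m / d, where m / 0 is + ∞.
infix 4 _≤ᵣ_//_
_≤ᵣ_//_ : ℝ → ℕ → ℕ → Set
x ≤ᵣ m // zero  = ⊤
x ≤ᵣ m // suc d = x ≤ᵣ fromℚ (+ m / suc d)

module Submission where

-- Lower bound: a tower has one block in each layer, and each block can be put on the one
-- below it in A ways, so there are A ^ (n - 1) towers starting from a fixed block.  A
-- building has at most four towers of this kind in its class, one for each rotation.
--
-- Upper bound: explore a building from a block, inspecting one after another the cells
-- directly above and below the blocks found so far.  Each of the n blocks contributes
-- σ = 2 b w cells, and exactly n - 1 of the σ n inspections find a new block, in one of m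
-- ways.  So T n is at most a constant times C(σ n, n - 1) m ^ (n - 1), which grows like
-- (m σ ^ σ / (σ - 1) ^ (σ - 1)) ^ n.

open import Defs
open import Algebra.Bundles using (AbelianGroup; CommutativeRing)
open import Data.Bool.Base using (Bool; true; false; not)
open import Data.Empty using (⊥-elim)
open import Data.Fin.Base using (Fin; zero; suc; toℕ; fromℕ<; combine; remQuot; splitAt; join; finToFun; funToFin)
import Data.Fin.Properties as Fin
open import Data.Integer.Base as ℤ using (ℤ; 0ℤ; +_)
import Data.Integer.Properties as ℤ
open import Data.Integer.Tactic.RingSolver using (solve-∀)
open import Data.List.Base as List using (List; []; _∷_; _++_; length; map; upTo; cartesianProduct; tabulate)
open import Data.List.Membership.Propositional using (_∈_; find; lose)
open import Data.List.Membership.Propositional.Properties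
import Data.List.Properties as List
open import Data.List.Relation.Binary.Permutation.Propositional
  using (_↭_; prep; ↭⇒↭ₛ; ↭-trans; ↭-sym; ↭-reflexive)
import Data.List.Relation.Binary.Permutation.Propositional.Properties as Perm
open import Data.List.Relation.Binary.Permutation.Setoid.Properties using (AllPairs-resp-↭)
open import Data.List.Relation.Unary.All as All using (All)
import Data.List.Relation.Unary.All.Properties as All
open import Data.List.Relation.Unary.AllPairs as AllPairs using (AllPairs)
import Data.List.Relation.Unary.AllPairs.Properties as AllPairs
open import Data.List.Relation.Unary.Any using (here; there; any?)
open import Data.Nat.Base as ℕ using (ℕ; zero; suc; s≤s; z≤n; >-nonZero; >-nonZero⁻¹)
open import Data.Nat.DivMod using (m≡m%n+[m/n]*n; m%n<n)
import Data.Nat.Properties as ℕ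
import Data.Nat.Tactic.RingSolver as NatSolver
open import Data.Product.Base using (∃; _×_; _,_; proj₁; proj₂)
open import Data.Sum.Base using (_⊎_; inj₁; inj₂; [_,_]′)
open import Data.Sum.Properties using (inj₁-injective; inj₂-injective)
open import Data.Unit.Base using (tt)
open import Data.Vec.Functional using (Vector)
open import Function.Base using (_∘_)
open import Function.Bundles using (module Bijection)
open import Relation.Binary.Construct.Closure.ReflexiveTransitive using (Star; ε; _◅_; _◅◅_; gmap)
open import Relation.Binary.PropositionalEquality
open import Relation.Nullary using (Dec; ¬_; yes; no; _×-dec_)
open import Algebra.Properties.Group (AbelianGroup.group ℤ.+-0-abelianGroup) using ()
  renaming (∙-cancelˡ to +-cancelˡ; ∙-cancelʳ to +-cancelʳ)

-- From counts to the entropy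

-- Each count is off by a constant factor: 4 and one factor A below, the orientations of the root
-- above. Powers of a ratio greater than 1 outgrow such factors, so they vanish in the limit. As log
-- (T n) and the exponential of s are cuts, all comparisons are between rationals: exp (n q) is
-- handled as the n-th power of `compound q k`, and a gap q < p pays for the error of convergence.
--
-- A code has to be readable without the building. Each new block is therefore recorded relative to
-- the inspected cell that it covers. Decoding then commutes with translations, so a code and the
-- orientation of the root determine a building up to translation. Contiguity makes the exploration
-- complete: the blocks never found are closed under attachment and miss the root, so there are
-- none.
--
-- The binomial coefficient is bounded by comparing one term of (1 + q) ^ N with the whole sum. The
-- choice q = σ - 1 makes the largest term the one of index about N / σ, which is the number of
-- blocks found, so the exponential rate is kept.

module Analysis where

  open import Data.Rational.Base using (0ℚ; 1ℚ; _<_; _≤_; _+_; _*_; _-_; -_; _/_; toℚᵘ; positive; nonNegative)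
  open import Data.Rational.Properties
  import Data.Rational.Unnormalised.Base as ℚᵘ
  import Data.Rational.Unnormalised.Properties as ℚᵘ
  open import Data.Rational.Solver using (module +-*-Solver)
  open import Algebra.Properties.CommutativeSemiring.Exp
    (CommutativeRing.commutativeSemiring +-*-commutativeRing) as Exp using (_^_)
  open +-*-Solver using (solve; _:=_; _:+_; _:*_; _:-_; con)
  open ℝ

  ι-+ : ∀ m n → ι (m ℕ.+ n) ≡ ι m + ι n
  ι-+ zero    n = trans (sym (+-identityˡ (ι n))) (cong (_+ ι n) {0ℚ} {ι 0} refl)
  ι-+ (suc m) n = begin
    ι (suc (m ℕ.+ n))     ≡⟨ ι-suc (m ℕ.+ n) ⟩
    1ℚ + ι (m ℕ.+ n)      ≡⟨ cong (λ u → 1ℚ + u) (ι-+ m n) ⟩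
    1ℚ + (ι m + ι n)      ≡⟨ +-assoc 1ℚ (ι m) (ι n) ⟨
    1ℚ + ι m + ι n        ≡⟨ cong (_+ ι n) (ι-suc m) ⟨
    ι (suc m) + ι n       ∎
    where open ≡-Reasoning

  ι-* : ∀ m n → ι (m ℕ.* n) ≡ ι m * ι n
  ι-* zero    n = trans (sym (*-zeroˡ (ι n))) (cong (_* ι n) {0ℚ} {ι 0} refl)
  ι-* (suc m) n = begin
    ι (n ℕ.+ m ℕ.* n)     ≡⟨ ι-+ n (m ℕ.* n) ⟩
    ι n + ι (m ℕ.* n)     ≡⟨ cong (λ u → ι n + u) (ι-* m n) ⟩
    ι n + ι m * ι n       ≡⟨ eq (ι m) (ι n) ⟩
    (1ℚ + ι m) * ι n      ≡⟨ cong (_* ι n) (ι-suc m) ⟨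
    ι (suc m) * ι n       ∎
    where
    open ≡-Reasoning
    eq : ∀ m n → n + m * n ≡ (1ℚ + m) * n
    eq = solve 2 (λ m n → n :+ m :* n := (con 1ℚ :+ m) :* n) refl

  ι-^ : ∀ m n → ι (m ℕ.^ n) ≡ ι m ^ n
  ι-^ m zero    = refl
  ι-^ m (suc n) = trans (ι-* m (m ℕ.^ n)) (cong (ι m *_) (ι-^ m n))

  0<ι : ∀ {n} → 0 ℕ.< n → 0ℚ < ι n
  0<ι {suc n} _ = 0<ι-suc n

  *-cancel-<ˡ : ∀ {r p q} → 0ℚ < r → r * p < r * q → p < q
  *-cancel-<ˡ {r} 0<r = *-cancelˡ-<-nonNeg r {{nonNegative (<⇒≤ 0<r)}}

  ^-mono-< : ∀ {a b} n → 0ℚ < a → a < b → a ^ suc n < b ^ suc n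
  ^-mono-< {a} {b} n 0<a a<b = ≤-<-trans
    (scale-≤ a (a ^ n) (b ^ n) 0<a (^-mono n 0<a (<⇒≤ a<b)))
    (*-monoˡ-<-pos (b ^ n) {{positive (^-pos n (<-trans 0<a a<b))}} a<b)

  ^-unbounded : ∀ {x} c → 1ℚ < x → ∃ λ N → ∀ n → N ℕ.≤ n → c < x ^ n
  ^-unbounded {x} c 1<x = from (reciprocal (<⇒0<- 1<x))
    where
    δ = x - 1ℚ
    1+δ≡x : 1ℚ + δ ≡ x
    1+δ≡x = solve 1 (λ x → con 1ℚ :+ (x :- con 1ℚ) := x) refl x
    from : (∃ λ e → 0ℚ < e × δ * e ≡ 1ℚ) → ∃ λ N → ∀ n → N ℕ.≤ n → c < x ^ n
    from (e , 0<e , δe≡1) with archimedean (c * e)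
    ... | N , ce<N = suc N , λ n N≤n → begin-strict
      c                   ≡⟨ *-identityʳ c ⟨
      c * 1ℚ              ≡⟨ cong (c *_) δe≡1 ⟨
      c * (δ * e)         ≡⟨ solve 3 (λ c d e → c :* (d :* e) := c :* e :* d) refl c δ e ⟩
      c * e * δ           <⟨ *-monoˡ-<-pos δ {{positive (<⇒0<- 1<x)}} (<-≤-trans ce<N (ι-mono N≤n)) ⟩
      ι n * δ             ≡⟨ +-identityˡ (ι n * δ) ⟨
      0ℚ + ι n * δ        ≤⟨ +-monoˡ-≤ (ι n * δ) (nonNegative⁻¹ 1ℚ) ⟩
      1ℚ + ι n * δ        ≤⟨ bernoulli n (subst (0ℚ ≤_) (sym 1+δ≡x) (<⇒≤ (<-trans (positive⁻¹ 1ℚ) 1<x))) ⟩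
      (1ℚ + δ) ^ n        ≡⟨ cong (_^ n) 1+δ≡x ⟩
      x ^ n               ∎
      where open ≤-Reasoning

  ι*inv : ∀ n k → ι (suc n) * inv (n ℕ.+ k ℕ.* suc n) ≡ inv k
  ι*inv n k = begin
    a * t               ≡⟨ *-identityʳ (a * t) ⟨
    a * t * 1ℚ          ≡⟨ cong (a * t *_) (ι-inv k) ⟨
    a * t * (c * u)     ≡⟨ eq a t c u ⟩
    c * a * t * u       ≡⟨ cong (λ v → v * t * u) (ι-* (suc k) (suc n)) ⟨
    ι (suc K) * t * u   ≡⟨ cong (_* u) (ι-inv K) ⟩
    1ℚ * u              ≡⟨ *-identityˡ u ⟩
    u                   ∎
    where
    open ≡-Reasoning
    K = n ℕ.+ k ℕ.* suc n
    a = ι (suc n)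
    t = inv K
    c = ι (suc k)
    u = inv k
    eq : ∀ a t c u → a * t * (c * u) ≡ c * a * t * u
    eq = solve 4 (λ a t c u → a :* t :* (c :* u) := c :* a :* t :* u) refl

  -- K + 1 = (k + 1) (n + 1), so both sides compound at the same rate over the same number of steps.
  -- This stands in for exp ((n + 1) q) = exp (q) ^ (n + 1).
  compound-scale : ∀ q n k → let K = n ℕ.+ k ℕ.* suc n in
    1ℚ + (ι (suc n) * q) * inv K ≡ 1ℚ + q * inv k ×
    compound (ι (suc n) * q) K ≡ compound q k ^ suc n
  compound-scale q n k = base , trans (cong (_^ suc K) base) (sym (Exp.^-assocʳ (1ℚ + q * inv k) (suc k) (suc n)))
    where
    K = n ℕ.+ k ℕ.* suc n
    base : 1ℚ + (ι (suc n) * q) * inv K ≡ 1ℚ + q * inv k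
    base = cong (λ u → 1ℚ + u)
      (trans (eq (ι (suc n)) q (inv K))
             (cong (q *_) (ι*inv n k)))
      where
      eq : ∀ a q t → a * q * t ≡ q * (a * t)
      eq = solve 3 (λ a q t → a :* q :* t := q :* (a :* t)) refl

  <exp-scale : ∀ {q r} n k → 0ℚ < 1ℚ + q * inv k → r < compound q k ^ suc n → r <exp (ι (suc n) * q)
  <exp-scale {q} {r} n k 0<a r< = let base , pow = compound-scale q n k in
    n ℕ.+ k ℕ.* suc n , subst (0ℚ <_) (sym base) 0<a , subst (r <_) (sym pow) r<

  exp<-scale : ∀ {q r} n k → 0ℚ < 1ℚ + - q * inv k → 1ℚ < r * compound (- q) k ^ suc n → (ι (suc n) * q) exp< r
  exp<-scale {q} {r} n k 0<b 1< = let base , pow = compound-scale (- q) n k in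
    K , subst (λ u → 0ℚ < 1ℚ + u * inv K) eq (subst (0ℚ <_) (sym base) 0<b) ,
    subst (λ u → 1ℚ < r * compound u K) eq (subst (λ u → 1ℚ < r * u) (sym pow) 1<)
    where
    K = n ℕ.+ k ℕ.* suc n
    eq : ι (suc n) * (- q) ≡ - (ι (suc n) * q)
    eq = sym (neg-distribʳ-* (ι (suc n)) q)

  -- Take q and q′ close on either side of log r. By `exp-located`, either r is below the
  -- exponential of q, contradicting q < log r, or q′ separates r from t.
  between : ∀ {r t} → 0ℚ < r → r < t → ∃ λ q → r <exp q × q exp< t
  between {r} {t} 0<r r<t = from (shrink 0<r r<t)
    where
    0<t : 0ℚ < t
    0<t = <-trans 0<r r<t
    decide : ∀ q q′ → q exp< r → r <exp q′ → r <exp q ⊎ q′ exp< t → ∃ λ q → r <exp q × q exp< t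
    decide q q′ q<r r<q′ (inj₁ r<q)  = ⊥-elim (<-irrefl {r} refl (exp-below<above {q} {q} {r} {r} ≤-refl r<q q<r))
    decide q q′ q<r r<q′ (inj₂ q′<t) = q′ , r<q′ , q′<t
    z< : ∀ q q′ z → q′ - q < 1ℚ - z → z < 1ℚ + (q - q′)
    z< q q′ z δ< = 0<-⇒< (subst (0ℚ <_) (eq q q′ z) (<⇒0<- δ<))
      where
      eq : ∀ q q′ z → 1ℚ - z - (q′ - q) ≡ 1ℚ + (q - q′) - z
      eq = solve 3 (λ q r z → con 1ℚ :- z :- (r :- q) := con 1ℚ :+ (q :- r) :- z) refl
    from : (∃ λ z → 0ℚ < z × z < 1ℚ × r < t * z) → ∃ λ q → r <exp q × q exp< t
    from (z , 0<z , z<1 , r<tz) =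
      let q , q′ , q<r , r<q′ , δ< = approximate (logℚ r 0<r) {1ℚ - z} (<⇒0<- z<1)
      in decide q q′ q<r r<q′ (exp-located {q} {q′} {r} {t} 0<r 0<t
           (<-trans r<tz (scale-< t z (1ℚ + (q - q′)) 0<t (z< q q′ z δ<))))

  p-[p-q] : ∀ p q → p - (p - q) ≡ q
  p-[p-q] = solve 2 (λ p q → p :- (p :- q) := q) refl

  below-log : ∀ {t} → 0 ℕ.< t → ∀ n {q} → (ι (suc n) * q) exp< ι t → below (log t /ᵣ suc n) q
  below-log {suc t} _ n h = h

  below-log⁻¹ : ∀ {t} → 0 ℕ.< t → ∀ n {q} → below (log t /ᵣ suc n) q → (ι (suc n) * q) exp< ι t
  below-log⁻¹ {suc t} _ n h = h

  ι-*-/ : ∀ m d → ι (suc d) * (+ m / suc d) ≡ ι m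
  ι-*-/ m d = toℚᵘ-injective (begin
    toℚᵘ (ι (suc d) * (+ m / suc d))              ≈⟨ toℚᵘ-homo-* (ι (suc d)) (+ m / suc d) ⟩
    toℚᵘ (ι (suc d)) ℚᵘ.* toℚᵘ (+ m / suc d)      ≈⟨ ℚᵘ.*-cong (toℚᵘ-fromℚᵘ (ℚᵘ.mkℚᵘ (+ suc d) 0)) (toℚᵘ-fromℚᵘ (ℚᵘ.mkℚᵘ (+ m) d)) ⟩
    ℚᵘ.mkℚᵘ (+ suc d) 0 ℚᵘ.* ℚᵘ.mkℚᵘ (+ m) d      ≈⟨ ℚᵘ.*≡* eq ⟩
    ℚᵘ.mkℚᵘ (+ m) 0                               ≈⟨ toℚᵘ-fromℚᵘ (ℚᵘ.mkℚᵘ (+ m) 0) ⟨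
    toℚᵘ (ι m)                                    ∎)
    where
    open ℚᵘ.≃-Reasoning
    eq : + suc d ℤ.* + m ℤ.* + 1 ≡ + m ℤ.* (+ suc (d ℕ.+ 0))
    eq = trans (ℤ.*-identityʳ (+ suc d ℤ.* + m)) (trans (ℤ.*-comm (+ suc d) (+ m))
           (cong (λ u → + m ℤ.* (+ suc u)) (sym (ℕ.+-identityʳ d))))

  module _ {T : ℕ → ℕ} {s : ℝ} (limit : ConvergesTo (λ n → log (T n) /ᵣ n) s)
           (positive-T : ∀ n → 0 ℕ.< T (suc n)) where

    -- Choose q < p whose exponentials lie between r and A. For large n the count exceeds the
    -- exponential of (n + 1) p, so p is below log (T (n + 1)) / (n + 1). Convergence up to p - q
    -- then puts q below s.
    growth≤ : ∀ {A C} → 0 ℕ.< A → 0 ℕ.< C → (∀ n → A ℕ.^ n ℕ.≤ C ℕ.* T (suc n)) → fromℕ A ≤ᵣ exp s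
    growth≤ {A} {C} 0<A 0<C A^n≤ {r} r<A = below-exp (0ℚ <? r)
      where
      -- B plays the role of exp (- p). The extra factor A makes up for the exponent n, instead of n
      -- + 1, in the hypothesis on T.
      beats : ∀ B → 0ℚ < B → ∀ n → ι C * ι A < (ι A * B) ^ suc n → 1ℚ < ι (T (suc n)) * B ^ suc n
      beats B 0<B n lt = *-cancel-<ˡ {ι C} {1ℚ} {ι (T (suc n)) * B ^ suc n} (0<ι 0<C) (begin-strict
        ι C * 1ℚ                        ≡⟨ *-identityʳ (ι C) ⟩
        ι C                             <⟨ *-cancel-<ˡ {ι A} {ι C} {ι A ^ n * B ^ suc n} (0<ι 0<A)
                                            (subst₂ _<_ (*-comm (ι C) (ι A)) split lt) ⟩
        ι A ^ n * B ^ suc n             ≤⟨ *-monoʳ-≤-nonNeg (B ^ suc n) {{nonNegative (<⇒≤ (^-pos (suc n) 0<B))}}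
                                            (subst₂ _≤_ (ι-^ A n) (ι-* C (T (suc n))) (ι-mono (A^n≤ n))) ⟩
        ι C * ι (T (suc n)) * B ^ suc n ≡⟨ *-assoc (ι C) (ι (T (suc n))) (B ^ suc n) ⟩
        ι C * (ι (T (suc n)) * B ^ suc n) ∎)
        where
        open ≤-Reasoning
        split : (ι A * B) ^ suc n ≡ ι A * (ι A ^ n * B ^ suc n)
        split = trans (Exp.^-distrib-* (ι A) B (suc n)) (*-assoc (ι A) (ι A ^ n) (B ^ suc n))
      below-q : ∀ q p k → q < p → 0ℚ < 1ℚ + - p * inv k → 1ℚ < ι A * compound (- p) k → below s q
      below-q q p k q<p 0<b 1<AB =
        let N , close = limit {p - q} (<⇒0<- {q} {p} q<p)
            M , beyond = ^-unbounded {ι A * compound (- p) k} (ι C * ι A) 1<AB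
            n = N ℕ.+ M
        in subst (below s) (p-[p-q] p q) (proj₁ (close (suc n) (ℕ.m≤n⇒m≤1+n (ℕ.m≤m+n N M)))
             (below-log (positive-T n) n {p} (exp<-scale {p} {ι (T (suc n))} n k 0<b
               (beats (compound (- p) k) (^-pos (suc k) 0<b) n
                 (beyond (suc n) (ℕ.m≤n⇒m≤1+n (ℕ.m≤n+m M N)))))))
      positive-case : 0ℚ < r → ∃ λ q → below s q × r <exp q
      positive-case 0<r =
        let q , r<q , q<A = between {r} {ι A} 0<r r<A
            p , q<p , k , 0<b , 1<AB = exp<-openʳ {q} {ι A} q<A
        in q , below-q q p k q<p 0<b 1<AB , r<q
      nonpositive-case : r ≤ 0ℚ → ∃ λ q → below s q × r <exp q
      nonpositive-case r≤0 =
        let q , bq = below-inhabited s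
            k , 0<a , 0<E = 0<exp q
        in q , bq , k , 0<a , ≤-<-trans {r} {0ℚ} {compound q k} r≤0 0<E
      below-exp : Dec (0ℚ < r) → ∃ λ q → below s q × r <exp q
      below-exp (yes 0<r) = positive-case 0<r
      below-exp (no 0≮r)  = nonpositive-case (≮⇒≥ 0≮r)

    -- If r′, chosen between r and exp q, exceeded M / (d + 1), the powers of r′ (d + 1) / M would
    -- outgrow C. But q lies below log (T (n + 1)) / (n + 1) for large n, so r′ ^ (n + 1) < T (n +
    -- 1), against the bound on T.
    ≤growth : ∀ {M C} d → 0 ℕ.< M → 0 ℕ.< C →
              (∀ n → T (suc n) ℕ.* suc d ℕ.^ suc n ℕ.≤ C ℕ.* M ℕ.^ suc n) → exp s ≤ᵣ fromℚ (+ M / suc d)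
    ≤growth {M} {C} d 0<M 0<C ≤M^n {r} (q , bq , k , 0<a , r<E) =
      let p , q<p , bp = below-open s bq
          r′ , 0<r′ , r<r′ , r′<E = positive-between (compound q k) (^-pos (suc k) 0<a) r<E
      in <-≤-trans {r} {r′} {+ M / suc d} r<r′ (≮⇒≥ {+ M / suc d} {r′} (absurd p q<p bp r′ 0<r′ r′<E))
      where
      D = ι (suc d)
      positive-between : ∀ E → 0ℚ < E → r < E → ∃ λ r′ → 0ℚ < r′ × r < r′ × r′ < E
      positive-between E 0<E r<E = go (0ℚ <? r)
        where
        go : Dec (0ℚ < r) → ∃ λ r′ → 0ℚ < r′ × r < r′ × r′ < E
        go (yes 0<r) = let m , r<m , m<E = <-dense {r} {E} r<E in m , <-trans 0<r r<m , r<m , m<E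
        go (no  0≮r) = let m , 0<m , m<E = <-dense {0ℚ} {E} 0<E in m , 0<m , ≤-<-trans (≮⇒≥ 0≮r) 0<m , m<E
      below-T : ∀ {r′} → 0ℚ < r′ → r′ < compound q k → ∀ n → (ι (suc n) * q) exp< ι (T (suc n)) → r′ ^ suc n < ι (T (suc n))
      below-T {r′} 0<r′ r′<E n h = exp-below<above {ι (suc n) * q} {ι (suc n) * q} {r′ ^ suc n} {ι (T (suc n))} ≤-refl
        (<exp-scale {q} {r′ ^ suc n} n k 0<a (^-mono-< {r′} {compound q k} n 0<r′ r′<E)) h
      bounded : ∀ r′ n → r′ ^ suc n < ι (T (suc n)) → (r′ * D) ^ suc n < ι C * ι M ^ suc n
      bounded r′ n lt = begin-strict
        (r′ * D) ^ suc n              ≡⟨ Exp.^-distrib-* r′ D (suc n) ⟩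
        r′ ^ suc n * D ^ suc n        <⟨ *-monoˡ-<-pos (D ^ suc n) {{positive (^-pos (suc n) (0<ι-suc d))}} lt ⟩
        ι (T (suc n)) * D ^ suc n     ≡⟨ cong (ι (T (suc n)) *_) (ι-^ (suc d) (suc n)) ⟨
        ι (T (suc n)) * ι (suc d ℕ.^ suc n)
                                      ≤⟨ subst₂ _≤_ (ι-* (T (suc n)) (suc d ℕ.^ suc n)) (ι-* C (M ℕ.^ suc n)) (ι-mono (≤M^n n)) ⟩
        ι C * ι (M ℕ.^ suc n)         ≡⟨ cong (ι C *_) (ι-^ M (suc n)) ⟩
        ι C * ι M ^ suc n             ∎
        where open ≤-Reasoning
      exceeds : ∀ {a e} n → ι M * e ≡ 1ℚ → ι C < (e * a) ^ suc n → ι C * ι M ^ suc n < a ^ suc n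
      exceeds {a} {e} n Me≡1 lt = begin-strict
        ι C * ι M ^ suc n             <⟨ *-monoˡ-<-pos (ι M ^ suc n) {{positive (^-pos (suc n) (0<ι 0<M))}} lt ⟩
        (e * a) ^ suc n * ι M ^ suc n ≡⟨ Exp.^-distrib-* (e * a) (ι M) (suc n) ⟨
        (e * a * ι M) ^ suc n         ≡⟨ cong (_^ suc n) (eq e a (ι M)) ⟩
        (ι M * e * a) ^ suc n         ≡⟨ cong (λ u → (u * a) ^ suc n) Me≡1 ⟩
        (1ℚ * a) ^ suc n              ≡⟨ cong (_^ suc n) (*-identityˡ a) ⟩
        a ^ suc n                     ∎
        where
        open ≤-Reasoning
        eq : ∀ e a m → e * a * m ≡ m * e * a
        eq = solve 3 (λ e a m → e :* a :* m := m :* e :* a) refl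
      absurd : ∀ p → q < p → below s p → ∀ r′ → 0ℚ < r′ → r′ < compound q k → ¬ (+ M / suc d < r′)
      absurd p q<p bp r′ 0<r′ r′<E lt =
        let e , 0<e , Me≡1 = reciprocal (0<ι 0<M)
            N , beyond = ^-unbounded {e * (r′ * D)} (ι C) (1<e[r′D] e 0<e Me≡1)
            N′ , close = limit {p - q} (<⇒0<- {q} {p} q<p)
            n = N ℕ.+ N′
        in <-asym {(r′ * D) ^ suc n} {ι C * ι M ^ suc n}
             (bounded r′ n (below-T 0<r′ r′<E n (below-log⁻¹ (positive-T n) n {q}
               (subst (below (log (T (suc n)) /ᵣ suc n)) (p-[p-q] p q)
                 (proj₂ (close (suc n) (ℕ.m≤n⇒m≤1+n (ℕ.m≤n+m N′ N))) bp)))))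
             (exceeds {r′ * D} {e} n Me≡1 (beyond (suc n) (ℕ.m≤n⇒m≤1+n (ℕ.m≤m+n N N′))))
        where
        1<e[r′D] : ∀ e → 0ℚ < e → ι M * e ≡ 1ℚ → 1ℚ < e * (r′ * D)
        1<e[r′D] e 0<e Me≡1 = subst (_< e * (r′ * D)) (trans (*-comm e (ι M)) Me≡1)
          (mul-monoˡ-< {ι M} {r′ * D} {e} 0<e
            (subst₂ _<_ (ι-*-/ M d) (*-comm D r′) (mul-monoˡ-< {+ M / suc d} {r′} {D} (0<ι-suc d) lt)))

open Analysis using (growth≤; ≤growth)

open import Data.Nat.Base using (NonZero; _+_; _*_; _∸_; _^_; _<_; _≤_; _%_; _/_)
open Box
open Building

-- Towers

i<i+n : ∀ i n .{{_ : NonZero n}} → i ℤ.< i ℤ.+ + n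
i<i+n i (suc n) = subst (ℤ._< i ℤ.+ + suc n) (ℤ.+-identityʳ i) (ℤ.+-monoʳ-< i (ℤ.+<+ (s≤s z≤n)))

intervals-meet : ∀ x y {m n} .{{_ : NonZero m}} .{{_ : NonZero n}} →
  x ℤ.< y ℤ.+ + n → y ℤ.< x ℤ.+ + m →
  ∃ λ i → (x ℤ.≤ i × i ℤ.< x ℤ.+ + m) × (y ℤ.≤ i × i ℤ.< y ℤ.+ + n)
intervals-meet x y {m} {n} x<y+n y<x+m with ℤ.≤-total x y
... | inj₁ x≤y = y , (x≤y , y<x+m) , ℤ.≤-refl , i<i+n y n
... | inj₂ y≤x = x , (ℤ.≤-refl , i<i+n x m) , y≤x , x<y+n

-- For p = 0 , 1 , … , m + n - 2 these are the corners of the intervals of length n that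
-- overlap an interval of length m with corner x.
overlapping : ℤ → ℕ → ℕ → ℤ
overlapping x n p = x ℤ.+ + suc p ℤ.- + n

overlapping-injective : ∀ x n {p q} → overlapping x n p ≡ overlapping x n q → p ≡ q
overlapping-injective x n {p} {q} eq =
  ℕ.suc-injective (ℤ.+-injective (+-cancelˡ x _ _ (+-cancelʳ (ℤ.- + n) _ _ eq)))

overlapping-meets : ∀ x m n {p} .{{_ : NonZero m}} .{{_ : NonZero n}} → suc p < m + n →
  ∃ λ i → (x ℤ.≤ i × i ℤ.< x ℤ.+ + m) × (overlapping x n p ℤ.≤ i × i ℤ.< overlapping x n p ℤ.+ + n)
overlapping-meets x m n {p} p< = intervals-meet x (overlapping x n p)
  (subst (x ℤ.<_) (sym (eq x (+ suc p) (+ n)))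
    (i<i+n x (suc p)))
  (subst (overlapping x n p ℤ.<_) (eq′ x (+ m) (+ n))
    (ℤ.+-monoˡ-< (ℤ.- + n) (ℤ.+-monoʳ-< x (ℤ.+<+ p<))))
  where
  eq : ∀ x p n → x ℤ.+ p ℤ.- n ℤ.+ n ≡ x ℤ.+ p
  eq = solve-∀
  eq′ : ∀ x m n → x ℤ.+ (m ℤ.+ n) ℤ.- n ≡ x ℤ.+ m
  eq′ = solve-∀

attached-above : ∀ {x y z x′ y′ dx dy dx′ dy′} →
  (∃ λ i → (x ℤ.≤ i × i ℤ.< x ℤ.+ + dx) × (x′ ℤ.≤ i × i ℤ.< x′ ℤ.+ + dx′)) →
  (∃ λ j → (y ℤ.≤ j × j ℤ.< y ℤ.+ + dy) × (y′ ℤ.≤ j × j ℤ.< y′ ℤ.+ + dy′)) →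
  Attached (box x y z dx dy) (box x′ y′ (z ℤ.+ + 1) dx′ dy′)
attached-above {z = z} (i , xi , xi′) (j , yj , yj′) =
  cong ℤ.∣_∣ (eq z) , i , j , (xi , yj) , (xi′ , yj′)
  where
  eq : ∀ z → z ℤ.- (z ℤ.+ + 1) ≡ ℤ.- + 1
  eq = solve-∀

attached-sym : ∀ {A B} → Attached A B → Attached B A
attached-sym {A} {B} (∣z-z′∣ , i , j , a , b) =
  trans (ℤ.∣i-j∣≡∣j-i∣ (z B) (z A)) ∣z-z′∣ , i , j , b , a

side₁ side₂ : ℕ → ℕ → Bool → ℕ
side₁ b w false = b
side₁ b w true  = w
side₂ b w o = side₁ w b o

side-block : ∀ b w o {x y z} → IsBlock b w (box x y z (side₁ b w o) (side₂ b w o))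
side-block b w false = inj₁ (refl , refl)
side-block b w true  = inj₂ (refl , refl)

side-nonZero : ∀ b w .{{_ : NonZero b}} .{{_ : NonZero w}} o → NonZero (side₁ b w o)
side-nonZero (suc b) (suc w) false = _
side-nonZero (suc b) (suc w) true  = _

funToFin-cong : ∀ {m n} {f g : Fin m → Fin n} → (∀ i → f i ≡ g i) → funToFin f ≡ funToFin g
funToFin-cong {zero}  eq = refl
funToFin-cong {suc m} eq = cong₂ combine (eq zero) (funToFin-cong (eq ∘ suc))

-- `Identified` allows any number of turns; this leaves four cases, the source of the factor 4.
turns-% : ∀ k B → turns k B ≡ turns (k % 4) B
turns-% k B = trans (cong (λ l → turns l B) (m≡m%n+[m/n]*n k 4))
  (trans (turns-+ (k % 4) (k / 4 * 4) B) (cong (turns (k % 4)) (turns-4* (k / 4) B)))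

-- The level sets force the two translations to agree.
towers-≗ : ∀ {n} (F : Vector Box (suc n)) (G G′ : Vector Box (suc n)) {t t′} →
  SameSet (shift t ∘ F) G → SameSet (shift t′ ∘ F) G′ →
  (∀ i → z (G i) ≡ + toℕ i) → (∀ i → z (G′ i) ≡ + toℕ i) →
  x (G zero) ≡ x (G′ zero) → y (G zero) ≡ y (G′ zero) → ∀ i → G i ≡ G′ i
towers-≗ F G G′ {a , b , c} {a′ , b′ , c′} (f , g) (f′ , g′) zG zG′ xG yG i =
  let j , Fj≡Gi , Fj≡G′i = match i in
  trans (sym Fj≡Gi) (trans (cong₃ (λ a b c → shift (a , b , c) (F j)) a≡a′ b≡b′ c≡c′) Fj≡G′i)
  where
  cong₃ : ∀ {A B C D : Set} (f : A → B → C → D) {x x′ y y′ z z′} → x ≡ x′ → y ≡ y′ → z ≡ z′ → f x y z ≡ f x′ y′ z′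
  cong₃ f refl refl refl = refl
  -- The block that t sends to level 0 is sent by t′ to a level at least 0, which bounds the
  -- vertical part of t by that of t′. Exchanging the roles gives equality.
  lower : ∀ {m n p} (F : Vector Box m) {G : Vector Box (suc n)} {G′ : Vector Box p} {t t′} →
    (∀ j → ∃ λ i → shift t (F i) ≡ G j) → (∀ i → ∃ λ j → shift t′ (F i) ≡ G′ j) →
    (∀ i → z (G i) ≡ + toℕ i) → (∀ i → z (G′ i) ≡ + toℕ i) → proj₂ (proj₂ t) ℤ.≤ proj₂ (proj₂ t′)
  lower F {G = G} {G′} {t} {t′} g f′ zG zG′ =
    let j , Fj≡G0 = g zero ; k , Fj≡G′k = f′ j in
    cancel (z (F j)) (subst₂ ℤ._≤_ (sym (trans (cong z Fj≡G0) (zG zero))) (sym (trans (cong z Fj≡G′k) (zG′ k))) (ℤ.+≤+ z≤n))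
    where
    cancel : ∀ u {v w} → u ℤ.+ v ℤ.≤ u ℤ.+ w → v ℤ.≤ w
    cancel u {v} {w} le = subst₂ ℤ._≤_ (eq u v) (eq u w) (ℤ.+-monoʳ-≤ (ℤ.- u) le)
      where
      eq : ∀ u v → ℤ.- u ℤ.+ (u ℤ.+ v) ≡ v
      eq = solve-∀
  c≡c′ : c ≡ c′
  c≡c′ = ℤ.≤-antisym (lower F {G = G} {G′} {t = a , b , c} {a′ , b′ , c′} g f′ zG zG′)
                     (lower F {G = G′} {G} {t = a′ , b′ , c′} {a , b , c} g′ f zG′ zG)
  -- With equal vertical parts a block lands on the same level in both towers, and the level is the
  -- index.
  match : ∀ i → ∃ λ j → shift (a , b , c) (F j) ≡ G i × shift (a′ , b′ , c′) (F j) ≡ G′ i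
  match i =
    let j , Fj≡Gi = g i ; k , Fj≡G′k = f′ j
        i≡k = Fin.toℕ-injective (ℤ.+-injective (trans (sym (zG i)) (trans (cong z (sym Fj≡Gi))
                (trans (cong (λ c → z (F j) ℤ.+ c) c≡c′) (trans (cong z Fj≡G′k) (zG′ k))))))
    in j , Fj≡Gi , subst (λ k → _ ≡ G′ k) (sym i≡k) Fj≡G′k
  a≡a′ : a ≡ a′
  a≡a′ = let j , e , e′ = match zero in
    +-cancelˡ (x (F j)) a a′ (trans (cong x e) (trans xG (sym (cong x e′))))
  b≡b′ : b ≡ b′
  b≡b′ = let j , e , e′ = match zero in
    +-cancelˡ (y (F j)) b b′ (trans (cong y e) (trans yG (sym (cong y e′))))

-- A step (o , p , q) puts on the current block a block of orientation o, whose corner is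
-- given by overlapping with offsets p and q.
Overlaps : ℕ → ℕ → Bool → Bool × ℕ × ℕ → Set
Overlaps b w o (o′ , p , q) = suc p < side₁ b w o + side₁ b w o′ × suc q < side₂ b w o + side₂ b w o′

-- A box stores side lengths and no orientation. A step can be read off a tower only if different
-- orientations offered at the same point have different sides, which is what `step-orientation`
-- asks. For square blocks it holds because every step keeps the orientation.
module Towers (b w : ℕ) .{{_ : NonZero b}} .{{_ : NonZero w}} {A : ℕ}
  (step : Bool → Fin A → Bool × ℕ × ℕ)
  (step-injective : ∀ o {a a′} → step o a ≡ step o a′ → a ≡ a′)
  (step-overlaps : ∀ o a → Overlaps b w o (step o a))
  (step-orientation : ∀ o a a′ → side₁ b w (proj₁ (step o a)) ≡ side₁ b w (proj₁ (step o a′)) →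
    proj₁ (step o a) ≡ proj₁ (step o a′))
  where

  tower : ∀ {n} → Bool → ℤ → ℤ → ℤ → Vector (Fin A) n → Vector Box (suc n)
  tower o x y z v zero = box x y z (side₁ b w o) (side₂ b w o)
  tower {suc n} o x y z v (suc i) = let o′ , p , q = step o (v zero) in
    tower o′ (overlapping x (side₁ b w o′) p) (overlapping y (side₂ b w o′) q) (z ℤ.+ + 1) (v ∘ suc) i

  tower-z : ∀ {n} o x y z₀ (v : Vector (Fin A) n) i → z (tower o x y z₀ v i) ≡ z₀ ℤ.+ + toℕ i
  tower-z o x y z₀ v zero = sym (ℤ.+-identityʳ z₀)
  tower-z {suc n} o x y z₀ v (suc i) =
    let o′ , p , q = step o (v zero) in
    trans (tower-z o′ (overlapping x (side₁ b w o′) p) (overlapping y (side₂ b w o′) q) (z₀ ℤ.+ + 1) (v ∘ suc) i)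
      (ℤ.+-assoc z₀ (+ 1) (+ toℕ i))

  tower-isBlock : ∀ {n} o x y z₀ (v : Vector (Fin A) n) i → IsBlock b w (tower o x y z₀ v i)
  tower-isBlock o x y z₀ v zero = side-block b w o {x} {y} {z₀}
  tower-isBlock {suc n} o x y z₀ v (suc i) = tower-isBlock _ _ _ _ (v ∘ suc) i

  tower-attached : ∀ {n} o x y z₀ (v : Vector (Fin A) (suc n)) →
    Attached (tower o x y z₀ v zero) (tower o x y z₀ v (suc zero))
  tower-attached o x y z₀ v = let o′ , p , q = step o (v zero) ; p< , q< = step-overlaps o (v zero) in
    attached-above {x} {y} {z₀}
      (overlapping-meets x (side₁ b w o) (side₁ b w o′) {{side-nonZero b w o}} {{side-nonZero b w o′}} p<)
      (overlapping-meets y (side₂ b w o) (side₂ b w o′) {{side-nonZero w b o}} {{side-nonZero w b o′}} q<)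

  tower-contiguous : ∀ {n} o x y z₀ (v : Vector (Fin A) n) i j →
    Star (λ k l → Attached (tower o x y z₀ v k) (tower o x y z₀ v l)) i j
  tower-contiguous o x y z₀ v zero zero = ε
  tower-contiguous {suc n} o x y z₀ v zero (suc j) =
    tower-attached o x y z₀ v ◅ gmap suc (λ a → a) (tower-contiguous _ _ _ _ (v ∘ suc) zero j)
  tower-contiguous {suc n} o x y z₀ v (suc i) zero =
    gmap suc (λ a → a) (tower-contiguous _ _ _ _ (v ∘ suc) i zero) ◅◅
    (attached-sym {tower o x y z₀ v zero} {tower o x y z₀ v (suc zero)}
      (tower-attached o x y z₀ v) ◅ ε)
  tower-contiguous {suc n} o x y z₀ v (suc i) (suc j) =
    gmap suc (λ a → a) (tower-contiguous _ _ _ _ (v ∘ suc) i j)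

  tower-injective : ∀ {n} o x y z₀ (v v′ : Vector (Fin A) n) →
    (∀ i → tower o x y z₀ v i ≡ tower o x y z₀ v′ i) → ∀ i → v i ≡ v′ i
  tower-injective {suc n} o x₀ y₀ z₀ v v′ eq = λ
    { zero    → first
    ; (suc i) → tower-injective _ _ _ _ (v ∘ suc) (v′ ∘ suc) rest i
    }
    where
    same-orientation = step-orientation o (v zero) (v′ zero) (cong dx (eq (suc zero)))
    cong-corner : ∀ {o o′ p p′ q q′} → o ≡ o′ →
      overlapping x₀ (side₁ b w o) p ≡ overlapping x₀ (side₁ b w o′) p′ →
      overlapping y₀ (side₂ b w o) q ≡ overlapping y₀ (side₂ b w o′) q′ →
      (o , p , q) ≡ (o′ , p′ , q′)
    cong-corner {o} refl ex ey = cong₂ (λ p q → o , p , q)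
      (overlapping-injective x₀ (side₁ b w o) ex) (overlapping-injective y₀ (side₂ b w o) ey)
    first : v zero ≡ v′ zero
    first = step-injective o (cong-corner same-orientation (cong x (eq (suc zero))) (cong y (eq (suc zero))))
    -- Once the first letters agree, both upper parts start from the same second block.
    rest : ∀ i → _
    rest i = subst (λ a → let o′ , p , q = step o (v zero) in _ ≡ (let o′ , p , q = step o a in
      tower o′ (overlapping x₀ (side₁ b w o′) p) (overlapping y₀ (side₂ b w o′) q) (z₀ ℤ.+ + 1) (v′ ∘ suc) i))
      (sym first) (eq (suc i))

  building : ∀ {n} → Vector (Fin A) n → Building b w (suc n)
  building v = record
    { blocks     = tower false 0ℤ 0ℤ 0ℤ v
    ; isBlock    = tower-isBlock false 0ℤ 0ℤ 0ℤ v
    ; disjoint   = λ i j i≢j (zi≡zj , _) → i≢j (Fin.toℕ-injective (ℤ.+-injective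
        (trans (sym (level v i)) (trans zi≡zj (level v j)))))
    ; contiguous = tower-contiguous false 0ℤ 0ℤ 0ℤ v
    }
    where
    level : ∀ {n} (v : Vector (Fin A) n) i → z (tower false 0ℤ 0ℤ 0ℤ v i) ≡ + toℕ i
    level v i = trans (tower-z false 0ℤ 0ℤ 0ℤ v i) (ℤ.+-identityˡ (+ toℕ i))

  -- A word is sent to its class and the rotation, modulo four, that takes the representative to its
  -- tower. Two words with the same image have towers that are translates of one set, so `towers-≗`
  -- applies.
  tower-count : ∀ {n t} → HasSize (buildings b w (suc n)) t → A ^ n ≤ 4 * t
  tower-count {n} {t} count = subst (A ^ n ≤_) (ℕ.*-comm t 4) (Fin.injective⇒≤ {f = key} key-injective)
    where
    open Bijection count using (to; to⁻; strictlySurjective)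
    word : Fin (A ^ n) → Vector (Fin A) n
    word = finToFun
    class : Fin (A ^ n) → Fin t
    class u = to⁻ (building (word u))
    motion : ∀ u → Identified (to (class u)) (building (word u))
    motion u = proj₂ (strictlySurjective (building (word u)))
    rotation : Fin (A ^ n) → ℕ
    rotation u = proj₁ (motion u) % 4
    rotation< : ∀ u → rotation u < 4
    rotation< u = m%n<n (proj₁ (motion u)) 4
    key : Fin (A ^ n) → Fin (t * 4)
    key u = combine (class u) (fromℕ< (rotation< u))
    rotated : ∀ u → SameSet
      (shift (proj₁ (proj₂ (motion u))) ∘ (turns (rotation u) ∘ blocks (to (class u))))
      (blocks (building (word u)))
    rotated u = let k , t , f , g = motion u in
      (λ i → let j , e = f i in j , trans (cong (shift t) (sym (turns-% k _))) e) ,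
      (λ j → let i , e = g j in i , trans (cong (shift t) (sym (turns-% k _))) e)
    level : ∀ u i → z (blocks (building (word u)) i) ≡ + toℕ i
    level u i = trans (tower-z false 0ℤ 0ℤ 0ℤ (word u) i) (ℤ.+-identityˡ (+ toℕ i))
    key-injective : ∀ {u u′} → key u ≡ key u′ → u ≡ u′
    key-injective {u} {u′} eq =
      let class≡ , rot≡ = Fin.combine-injective (class u) _ (class u′) _ eq
          rotation≡ = trans (sym (Fin.toℕ-fromℕ< (rotation< u))) (trans (cong toℕ rot≡) (Fin.toℕ-fromℕ< (rotation< u′)))
          same = towers-≗ (turns (rotation u) ∘ blocks (to (class u))) (blocks (building (word u)))
            (blocks (building (word u′)))
            (rotated u)
            (subst₂ (λ r c → SameSet (shift (proj₁ (proj₂ (motion u′))) ∘ (turns r ∘ blocks (to c)))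
               (blocks (building (word u′))))
               (sym rotation≡) (sym class≡) (rotated u′))
            (level u) (level u′) refl refl
      in word-injective u u′ (tower-injective false 0ℤ 0ℤ 0ℤ (word u) (word u′) same)
      where
      word-injective : ∀ u u′ → (∀ i → word u i ≡ word u′ i) → u ≡ u′
      word-injective u u′ eq = trans (sym (Fin.funToFin-finToFin {n} {A} u)) (trans (funToFin-cong eq)
        (Fin.funToFin-finToFin {n} {A} u′))

-- The number of ways to put one block on another

<∸1⇒suc< : ∀ {p m} → p < m ∸ 1 → suc p < m
<∸1⇒suc< {m = suc m} p<m = s≤s p<m

<2*∸1⇒suc< : ∀ {p} b → p < 2 * b ∸ 1 → suc p < b + b
<2*∸1⇒suc< {p} b p< = subst (suc p <_) (cong (λ c → b + c) (ℕ.+-identityʳ b)) (<∸1⇒suc< p<)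

remQuot-injective : ∀ {m} n {i j : Fin (m * n)} →
  toℕ (proj₁ (remQuot {m} n i)) ≡ toℕ (proj₁ (remQuot {m} n j)) →
  toℕ (proj₂ (remQuot {m} n i)) ≡ toℕ (proj₂ (remQuot {m} n j)) → i ≡ j
remQuot-injective {m} n {i} {j} eq₁ eq₂ = trans (sym (Fin.combine-remQuot {m} n i))
  (trans (cong₂ combine (Fin.toℕ-injective eq₁) (Fin.toℕ-injective eq₂)) (Fin.combine-remQuot {m} n j))

square-tower-count : ∀ b .{{_ : NonZero b}} {n t} → HasSize (buildings b b (suc n)) t →
  ((2 * b ∸ 1) * (2 * b ∸ 1)) ^ n ≤ 4 * t
square-tower-count b = tower-count
  where
  K = 2 * b ∸ 1
  side : ∀ o → side₁ b b o ≡ b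
  side false = refl
  side true  = refl
  offsets : Fin (K * K) → Fin K × Fin K
  offsets = remQuot {K} K
  step : Bool → Fin (K * K) → Bool × ℕ × ℕ
  step o a = o , toℕ (proj₁ (offsets a)) , toℕ (proj₂ (offsets a))
  overlaps : ∀ o (p : Fin K) → suc (toℕ p) < side₁ b b o + side₁ b b o
  overlaps o p rewrite side o = <2*∸1⇒suc< b (Fin.toℕ<n p)
  open Towers b b step
    (λ o {a} {a′} eq → remQuot-injective K (cong (proj₁ ∘ proj₂) eq) (cong (proj₂ ∘ proj₂) eq))
    (λ o a → overlaps o (proj₁ (offsets a)) , overlaps o (proj₂ (offsets a)))
    (λ o a a′ _ → refl)

-- A parallel block has b + b - 1 and w + w - 1 possible offsets along its two axes; a perpendicular
-- one has b + w - 1 along each.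
tower-count : ∀ b w .{{_ : NonZero b}} .{{_ : NonZero w}} → b ≢ w → ∀ {n t} → HasSize (buildings b w (suc n)) t →
  ((2 * b ∸ 1) * (2 * w ∸ 1) + (b + w ∸ 1) * (b + w ∸ 1)) ^ n ≤ 4 * t
tower-count b w b≢w = Towers.tower-count b w step step-injective overlaps
  (λ o a a′ → side-injective {proj₁ (step o a)} {proj₁ (step o a′)})
  where
  K = 2 * b ∸ 1
  L = 2 * w ∸ 1
  M = b + w ∸ 1
  side-injective : ∀ {o o′} → side₁ b w o ≡ side₁ b w o′ → o ≡ o′
  side-injective {false} {false} _ = refl
  side-injective {false} {true}  b≡w = ⊥-elim (b≢w b≡w)
  side-injective {true}  {false} w≡b = ⊥-elim (b≢w (sym w≡b))
  side-injective {true}  {true}  _ = refl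
  parallel : Bool → Fin (K * L) → Bool × ℕ × ℕ
  parallel false a = let p , q = remQuot {K} L a in false , toℕ p , toℕ q
  -- The first offset always belongs to the sides of length b, which now lie along the second axis.
  parallel true  a = let p , q = remQuot {K} L a in true , toℕ q , toℕ p
  perpendicular : Bool → Fin (M * M) → Bool × ℕ × ℕ
  perpendicular o a = let p , q = remQuot {M} M a in not o , toℕ p , toℕ q
  step′ : Bool → Fin (K * L) ⊎ Fin (M * M) → Bool × ℕ × ℕ
  step′ o (inj₁ a) = parallel o a
  step′ o (inj₂ a) = perpendicular o a
  step : Bool → Fin (K * L + M * M) → Bool × ℕ × ℕ
  step o a = step′ o (splitAt (K * L) a)
  step′-injective : ∀ o {a a′} → step′ o a ≡ step′ o a′ → a ≡ a′
  step′-injective false {inj₁ a} {inj₁ a′} eq =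
    cong inj₁ (remQuot-injective L (cong (proj₁ ∘ proj₂) eq) (cong (proj₂ ∘ proj₂) eq))
  step′-injective true  {inj₁ a} {inj₁ a′} eq =
    cong inj₁ (remQuot-injective L (cong (proj₂ ∘ proj₂) eq) (cong (proj₁ ∘ proj₂) eq))
  step′-injective false {inj₁ a} {inj₂ a′} ()
  step′-injective true  {inj₁ a} {inj₂ a′} ()
  step′-injective false {inj₂ a} {inj₁ a′} ()
  step′-injective true  {inj₂ a} {inj₁ a′} ()
  step′-injective o     {inj₂ a} {inj₂ a′} eq =
    cong inj₂ (remQuot-injective M (cong (proj₁ ∘ proj₂) eq) (cong (proj₂ ∘ proj₂) eq))
  step-injective : ∀ o {a a′} → step o a ≡ step o a′ → a ≡ a′
  step-injective o {a} {a′} eq = trans (sym (Fin.join-splitAt (K * L) (M * M) a))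
    (trans (cong (join (K * L) (M * M)) (step′-injective o {splitAt (K * L) a} {splitAt (K * L) a′} eq))
      (Fin.join-splitAt (K * L) (M * M) a′))
  overlaps′ : ∀ o a → Overlaps b w o (step′ o a)
  overlaps′ false (inj₁ a) = let p , q = remQuot {K} L a in <2*∸1⇒suc< b (Fin.toℕ<n p) , <2*∸1⇒suc< w (Fin.toℕ<n q)
  overlaps′ true  (inj₁ a) = let p , q = remQuot {K} L a in <2*∸1⇒suc< w (Fin.toℕ<n q) , <2*∸1⇒suc< b (Fin.toℕ<n p)
  overlaps′ false (inj₂ a) = let p , q = remQuot {M} M a in
    <∸1⇒suc< (Fin.toℕ<n p) , subst (suc (toℕ q) <_) (ℕ.+-comm b w) (<∸1⇒suc< (Fin.toℕ<n q))
  overlaps′ true  (inj₂ a) = let p , q = remQuot {M} M a in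
    subst (suc (toℕ p) <_) (ℕ.+-comm b w) (<∸1⇒suc< (Fin.toℕ<n p)) , <∸1⇒suc< (Fin.toℕ<n q)
  overlaps : ∀ o a → Overlaps b w o (step o a)
  overlaps o a = overlaps′ o (splitAt (K * L) a)

-- Exploration of a building

data Code (m : ℕ) : ℕ → ℕ → Set where
  []   : Code m 0 0
  skip : ∀ {N j} → Code m N j → Code m (suc N) j
  pick : ∀ {N j} → Fin m → Code m N j → Code m (suc N) (suc j)

skips : ∀ {m} N → Code m N 0
skips zero    = []
skips (suc N) = skip (skips N)

-- The recurrence splits on the first letter of a code, as Pascal's rule does, so that `index` is
-- structural.
codes : ℕ → ℕ → ℕ → ℕ
codes m zero    zero    = 1
codes m zero    (suc j) = 0
codes m (suc N) zero    = codes m N zero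
codes m (suc N) (suc j) = codes m N (suc j) + m * codes m N j

index : ∀ {m N j} → Code m N j → Fin (codes m N j)
index []                             = zero
index {j = zero}          (skip c)   = index c
index {m} {suc N} {suc j} (skip c)   = join (codes m N (suc j)) (m * codes m N j) (inj₁ (index c))
index {m} {suc N} {suc j} (pick a c) = join (codes m N (suc j)) (m * codes m N j) (inj₂ (combine a (index c)))

join-injective : ∀ m n x y → join m n x ≡ join m n y → x ≡ y
join-injective m n x y eq =
  trans (sym (Fin.splitAt-join m n x)) (trans (cong (splitAt m) eq) (Fin.splitAt-join m n y))

index-injective : ∀ {m N j} (c d : Code m N j) → index c ≡ index d → c ≡ d
index-injective []       []       eq = refl
index-injective {j = zero} (skip c) (skip d) eq = cong skip (index-injective c d eq)
index-injective {m} {suc N} {suc j} (skip c) (skip d) eq = cong skip (index-injective c d (inj₁-injective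
  (join-injective (codes m N (suc j)) (m * codes m N j) (inj₁ (index c)) (inj₁ (index d)) eq)))
index-injective {m} {suc N} {suc j} (skip c) (pick a d) eq
  with () ← join-injective (codes m N (suc j)) (m * codes m N j) (inj₁ (index c)) (inj₂ (combine a (index d))) eq
index-injective {m} {suc N} {suc j} (pick a c) (skip d) eq
  with () ← join-injective (codes m N (suc j)) (m * codes m N j) (inj₂ (combine a (index c))) (inj₁ (index d)) eq
index-injective {m} {suc N} {suc j} (pick a c) (pick a′ d) eq =
  let a≡a′ , c≡d = Fin.combine-injective a (index c) a′ (index d) (inj₂-injective
        (join-injective (codes m N (suc j)) (m * codes m N j) (inj₂ (combine a (index c))) (inj₂ (combine a′ (index d))) eq))
  in cong₂ pick a≡a′ (index-injective c d c≡d)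

-- Cells and the blocks covering them

Slot : Set
Slot = ℤ × ℤ × ℤ

-- The slot (i , j , k) stands for the unit cube with this least corner; the condition is that the
-- cube lies in B.
Covers : Box → Slot → Set
Covers B (i , j , k) = z B ≡ k × HasStud B i j

covers? : ∀ B s → Dec (Covers B s)
covers? B (i , j , k) = (z B ℤ.≟ k) ×-dec
  (((x B ℤ.≤? i) ×-dec (i ℤ.<? x B ℤ.+ + dx B)) ×-dec ((y B ℤ.≤? j) ×-dec (j ℤ.<? y B ℤ.+ + dy B)))

covers-meet : ∀ {A B} s → Covers A s → Covers B s → InteriorsMeet A B
covers-meet (i , j , k) (zA , a) (zB , b) = trans zA (sym zB) , i , j , a , b

interval-offset : ∀ {a i n} → a ℤ.≤ i → i ℤ.< a ℤ.+ + n → ∃ λ (p : Fin n) → i ≡ a ℤ.+ + toℕ p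
interval-offset {a} {i} {n} a≤i i<a+n = fromℕ< p<n , trans (eq a i)
  (cong (λ u → a ℤ.+ u) (trans (sym +p) (cong +_ (sym (Fin.toℕ-fromℕ< p<n)))))
  where
  eq : ∀ a i → i ≡ a ℤ.+ (i ℤ.- a)
  eq = solve-∀
  eq′ : ∀ a n → a ℤ.+ n ℤ.- a ≡ n
  eq′ = solve-∀
  +p : + ℤ.∣ i ℤ.- a ∣ ≡ i ℤ.- a
  +p = ℤ.0≤i⇒+∣i∣≡i (ℤ.i≤j⇒0≤j-i a≤i)
  p<n : ℤ.∣ i ℤ.- a ∣ < n
  p<n = ℤ.drop‿+<+ (subst₂ ℤ._<_ (sym +p) (eq′ a (+ n)) (ℤ.+-monoˡ-< (ℤ.- a) i<a+n))

-- Relative to the corner of a block of size dx × dy, the cells where a block attached to it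
-- can have a stud.
offsets : ℕ → ℕ → List (ℤ × ℕ × ℕ)
offsets dx dy = cartesianProduct (+ 1 ∷ ℤ.- + 1 ∷ []) (cartesianProduct (upTo dx) (upTo dy))

cell : Box → ℤ × ℕ × ℕ → Slot
cell B (e , p , q) = x B ℤ.+ + p , y B ℤ.+ + q , z B ℤ.+ e

slots : Box → List Slot
slots B = map (cell B) (offsets (dx B) (dy B))

length-cartesianProduct : ∀ {X Y : Set} (xs : List X) (ys : List Y) →
  length (cartesianProduct xs ys) ≡ length xs * length ys
length-cartesianProduct []       ys = refl
length-cartesianProduct (x ∷ xs) ys = trans (List.length-++ (map (x ,_) ys))
  (cong₂ _+_ (List.length-map (x ,_) ys) (length-cartesianProduct xs ys))

length-slots : ∀ B → length (slots B) ≡ 2 * (dx B * dy B)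
length-slots B = trans (List.length-map (cell B) (offsets (dx B) (dy B)))
  (trans (length-cartesianProduct (+ 1 ∷ ℤ.- + 1 ∷ []) (cartesianProduct (upTo (dx B)) (upTo (dy B))))
    (cong (2 *_) (trans (length-cartesianProduct (upTo (dx B)) (upTo (dy B)))
      (cong₂ _*_ (List.length-upTo (dx B)) (List.length-upTo (dy B))))))

length-slots-block : ∀ {b w B} → IsBlock b w B → length (slots B) ≡ 2 * (b * w)
length-slots-block {b} {w} {B} (inj₁ (refl , refl)) = length-slots B
length-slots-block {b} {w} {B} (inj₂ (refl , refl)) = trans (length-slots B) (cong (2 *_) (ℕ.*-comm w b))

∣i∣≡1 : ∀ {i} → ℤ.∣ i ∣ ≡ 1 → i ∈ (+ 1 ∷ ℤ.- + 1 ∷ [])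
∣i∣≡1 {+ 1}        refl = here refl
∣i∣≡1 {ℤ.-[1+ 0 ]} refl = there (here refl)

-- The witness is the shared stud moved to the level of B, its height written as z A plus a
-- difference of ± 1 to match `cell`.
attached⇒covers : ∀ {A B} → Attached A B → ∃ λ s → s ∈ slots A × Covers B s
attached⇒covers {A} {B} (∣z-z′∣ , i , j , ((x≤i , i<) , (y≤j , j<)) , b) =
  let p , i≡ = interval-offset x≤i i<
      q , j≡ = interval-offset y≤j j<
  in (i , j , z A ℤ.+ (z B ℤ.- z A)) ,
     subst (_∈ slots A) (cong₂ (λ i j → i , j , z A ℤ.+ (z B ℤ.- z A)) (sym i≡) (sym j≡))
       (∈-map⁺ (cell A) (∈-cartesianProduct⁺ (∣i∣≡1 (trans (ℤ.∣i-j∣≡∣j-i∣ (z B) (z A)) ∣z-z′∣))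
         (∈-cartesianProduct⁺ (∈-upTo⁺ (Fin.toℕ<n p)) (∈-upTo⁺ (Fin.toℕ<n q))))) ,
     eq (z A) (z B) , b
  where
  eq : ∀ u v → v ≡ u ℤ.+ (v ℤ.- u)
  eq = solve-∀

shiftSlot : ℤ × ℤ × ℤ → Slot → Slot
shiftSlot (a , b , c) (i , j , k) = i ℤ.+ a , j ℤ.+ b , k ℤ.+ c

+-swapʳ : ∀ x p a → x ℤ.+ a ℤ.+ p ≡ x ℤ.+ p ℤ.+ a
+-swapʳ = solve-∀

slots-shift : ∀ t B → slots (shift t B) ≡ map (shiftSlot t) (slots B)
slots-shift t@(a , b , c) B = trans (List.map-cong shifted os) (List.map-∘ os)
  where
  os = offsets (dx B) (dy B)
  shifted : ∀ o → cell (shift t B) o ≡ shiftSlot t (cell B o)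
  shifted (e , p , q) = cong₂ _,_ (+-swapʳ (x B) (+ p) a)
    (cong₂ _,_ (+-swapʳ (y B) (+ q) b) (+-swapʳ (z B) e c))


-- For b = w the two orientations are the same, and counting them once is what makes the
-- bound for square blocks smaller.
module Exploration (b w : ℕ) {o : ℕ} (orientation : Fin o → Bool)
  (orient : ∀ B → IsBlock b w B → ∃ λ i → dx B ≡ side₁ b w (orientation i) × dy B ≡ side₂ b w (orientation i))
  where

  -- A block covering a given cell is determined by its orientation and by which of its b w studs
  -- sits in the cell; this gives `m`.
  σ m : ℕ
  σ = 2 * (b * w)
  m = o * (b * w)

  placeAs : Bool → Slot → Fin b → Fin w → Box
  placeAs false (i , j , k) p q = box (i ℤ.- + toℕ p) (j ℤ.- + toℕ q) k b w
  placeAs true  (i , j , k) p q = box (i ℤ.- + toℕ q) (j ℤ.- + toℕ p) k w b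

  placeOf : Slot → Fin o × Fin (b * w) → Box
  placeOf s (i , r) = let p , q = remQuot {b} w r in placeAs (orientation i) s p q

  place : Slot → Fin m → Box
  place s a = placeOf s (remQuot {o} (b * w) a)

  place-combine : ∀ s i p q → place s (combine i (combine p q)) ≡ placeAs (orientation i) s p q
  place-combine s i p q = trans (cong (placeOf s) (Fin.remQuot-combine i (combine p q)))
    (cong (λ (p , q) → placeAs (orientation i) s p q) (Fin.remQuot-combine p q))

  placeAs-shift : ∀ o t s p q → placeAs o (shiftSlot t s) p q ≡ shift t (placeAs o s p q)
  placeAs-shift false (a , b , c) (i , j , k) p q = corner (+-swapʳ i (ℤ.- + toℕ p) a) (+-swapʳ j (ℤ.- + toℕ q) b) refl
  placeAs-shift true  (a , b , c) (i , j , k) p q = corner (+-swapʳ i (ℤ.- + toℕ q) a) (+-swapʳ j (ℤ.- + toℕ p) b) refl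

  place-shift : ∀ t s a → place (shiftSlot t s) a ≡ shift t (place s a)
  place-shift t s a = let i , r = remQuot {o} (b * w) a ; p , q = remQuot {b} w r in
    placeAs-shift (orientation i) t s p q

  covers⇒placed : ∀ {B} s → IsBlock b w B → Covers B s → ∃ λ a → place s a ≡ B
  covers⇒placed {B} s@(i , j , k) isB (z≡k , (x≤i , i<) , (y≤j , j<)) with orient B isB
  ... | r , dx≡ , dy≡ = placed (orientation r) refl dx≡ dy≡
    where
    solution : ∀ {a i p} → i ≡ a ℤ.+ p → i ℤ.- p ≡ a
    solution {a} {_} {p} refl = +-neg-cancel a p
    placed : ∀ o → orientation r ≡ o → dx B ≡ side₁ b w o → dy B ≡ side₂ b w o → ∃ λ a → place s a ≡ B
    placed false o≡ refl refl =
      let p , i≡ = interval-offset x≤i i< ; q , j≡ = interval-offset y≤j j< in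
      combine r (combine p q) , trans (place-combine s r p q) (trans (cong (λ o → placeAs o s p q) o≡)
        (corner (solution i≡) (solution j≡) (sym z≡k)))
    placed true o≡ refl refl =
      let q , i≡ = interval-offset x≤i i< ; p , j≡ = interval-offset y≤j j< in
      combine r (combine p q) , trans (place-combine s r p q) (trans (cong (λ o → placeAs o s p q) o≡)
        (corner (solution i≡) (solution j≡) (sym z≡k)))

  -- The cells still to be inspected form a stack; a code says for each of them which block
  -- not yet found covers it.
  decode : ∀ {N j} → List Slot → Code m N j → List Box
  decode Q       []         = []
  decode []      (skip c)   = []
  decode []      (pick a c) = []
  decode (s ∷ Q) (skip c)   = decode Q c
  decode (s ∷ Q) (pick a c) = place s a ∷ decode (slots (place s a) ++ Q) c

  decode-skips : ∀ N → decode [] (skips N) ≡ []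
  decode-skips zero    = refl
  decode-skips (suc N) = refl

  decode-shift : ∀ {N j} t Q (c : Code m N j) → decode (map (shiftSlot t) Q) c ≡ map (shift t) (decode Q c)
  decode-shift t []      []         = refl
  decode-shift t (s ∷ Q) []         = refl
  decode-shift t []      (skip c)   = refl
  decode-shift t []      (pick a c) = refl
  decode-shift t (s ∷ Q) (skip c)   = decode-shift t Q c
  decode-shift t (s ∷ Q) (pick a c) = cong₂ _∷_ (place-shift t s a)
    (trans (cong (λ S → decode S c) (trans (cong (_++ map (shiftSlot t) Q)
               (trans (cong slots (place-shift t s a)) (slots-shift t (place s a))))
             (sym (List.map-++ (shiftSlot t) (slots (place s a)) Q))))
           (decode-shift t (slots (place s a) ++ Q) c))

  Apart : Box → Box → Set
  Apart A B = ¬ InteriorsMeet A B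

  apart-sym : ∀ {A B} → Apart A B → Apart B A
  apart-sym A#B (z≡z′ , i , j , p , q) = A#B (sym z≡z′ , i , j , q , p)

  -- `uncovered` is the statement that the induction carries, as the stack holds the cells of blocks
  -- found earlier. Started from the cells of the root, it and `closed` say that no leftover block
  -- is attached to the root or to a found block.
  record Explored N (Q : List Slot) (U : List Box) : Set where
    field
      {found}   : ℕ
      code      : Code m N found
      rest      : List Box
      partition : U ↭ decode Q code ++ rest
      size      : length (decode Q code) ≡ found
      uncovered : ∀ {B s} → B ∈ rest → s ∈ Q → ¬ Covers B s
      closed    : ∀ {B A s} → B ∈ rest → A ∈ decode Q code → s ∈ slots A → ¬ Covers B s

  -- N is the number of inspections due if all of U gets found: each inspection takes one cell off
  -- the stack, and a find moves a block out of U and adds its σ cells.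
  explore : ∀ N Q U → N ≡ length Q + length U * σ → All (IsBlock b w) U → AllPairs Apart U → Explored N Q U
  -- Blocks not reached go to `rest`, and skips pad the code to length N.
  explore N [] U _ _ _ = record
    { code      = skips N
    ; rest      = U
    ; partition = ↭-reflexive (cong (_++ U) (sym (decode-skips N)))
    ; size      = cong length (decode-skips N)
    ; uncovered = λ _ ()
    ; closed    = λ _ A∈ → ⊥-elim (¬∈[] (subst (_ ∈_) (decode-skips N) A∈))
    }
    where
    ¬∈[] : ∀ {A : Box} → ¬ A ∈ []
    ¬∈[] ()
  explore (suc N) (s ∷ Q) U N≡ blocks apart with any? (λ u → covers? u s) U
  ... | no ∄ = record
    { code      = skip (E.code)
    ; rest      = E.rest
    ; partition = E.partition
    ; size      = E.size
    ; uncovered = λ { B∈ (here refl) cov → ∄ (lose (Perm.∈-resp-↭ (↭-sym E.partition) (∈-++⁺ʳ _ B∈)) cov)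
                    ; B∈ (there s∈) → E.uncovered B∈ s∈ }
    ; closed    = E.closed
    }
    where module E = Explored (explore N Q U (ℕ.suc-injective N≡) blocks apart)
  ... | yes ∃u with find ∃u
  ...   | u , u∈U , u∋s with covers⇒placed s (All.lookup blocks u∈U) u∋s | ∈-∃++ u∈U
  ...     | a , refl | ys , zs , refl = record
    { code      = pick a E.code
    ; rest      = E.rest
    ; partition = ↭-trans U↭ (prep u E.partition)
    ; size      = cong suc E.size
    -- `u` covers `s`, and a second block covering `s` would meet `u`.
    ; uncovered = λ { B∈ (here refl) cov → All.lookup (AllPairs.head apart′) (rest⊆ B∈) (covers-meet s u∋s cov)
                    ; B∈ (there s∈) → E.uncovered B∈ (∈-++⁺ʳ (slots u) s∈) }
    -- The cells of `u` are on the stack of the recursive call.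
    ; closed    = λ { B∈ (here refl) s∈ → E.uncovered B∈ (∈-++⁺ˡ s∈)
                    ; B∈ (there A∈) → E.closed B∈ A∈ }
    }
    where
    U′ = ys ++ zs
    U↭ : U ↭ u ∷ U′
    U↭ = Perm.shift u ys zs
    blocks′ : All (IsBlock b w) (u ∷ U′)
    blocks′ = Perm.All-resp-↭ U↭ blocks
    apart′ : AllPairs Apart (u ∷ U′)
    apart′ = AllPairs-resp-↭ (setoid Box) apart-sym ((λ { refl p → p }) , (λ { refl p → p })) (↭⇒↭ₛ U↭) apart
    fuel : N ≡ length (slots u ++ Q) + length U′ * σ
    fuel = ℕ.suc-injective (begin
      suc N                                         ≡⟨ N≡ ⟩
      suc (length Q) + length U * σ                 ≡⟨ cong (λ n → suc (length Q) + n * σ) (Perm.↭-length U↭) ⟩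
      suc (length Q) + (σ + length U′ * σ)          ≡⟨ ℕ.+-assoc (suc (length Q)) σ _ ⟨
      suc (length Q) + σ + length U′ * σ            ≡⟨ cong (_+ length U′ * σ) (ℕ.+-comm (suc (length Q)) σ) ⟩
      σ + suc (length Q) + length U′ * σ            ≡⟨ cong (_+ length U′ * σ) (ℕ.+-suc σ (length Q)) ⟩
      suc (σ + length Q + length U′ * σ)            ≡⟨ cong (λ n → suc (n + length Q + length U′ * σ))
                                                         (length-slots-block {B = u} (All.head blocks′)) ⟨
      suc (length (slots u) + length Q + length U′ * σ) ≡⟨ cong (λ n → suc (n + length U′ * σ)) (List.length-++ (slots u)) ⟨
      suc (length (slots u ++ Q) + length U′ * σ)   ∎)
      where open ≡-Reasoning
    module E = Explored (explore N (slots u ++ Q) U′ fuel (All.tail blocks′) (AllPairs.tail apart′))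
    rest⊆ : ∀ {B} → B ∈ E.rest → B ∈ U′
    rest⊆ B∈ = Perm.∈-resp-↭ (↭-sym E.partition) (∈-++⁺ʳ _ B∈)

  -- Completeness of the exploration and the count of buildings

  module _ .{{_ : NonZero b}} .{{_ : NonZero w}} where

    block-meets-itself : ∀ {B} → IsBlock b w B → InteriorsMeet B B
    block-meets-itself {B} isB =
      refl , x B , y B , ((ℤ.≤-refl , proj₁ (sizes isB)) , (ℤ.≤-refl , proj₂ (sizes isB))) ,
                         ((ℤ.≤-refl , proj₁ (sizes isB)) , (ℤ.≤-refl , proj₂ (sizes isB)))
      where
      sizes : IsBlock b w B → x B ℤ.< x B ℤ.+ + dx B × y B ℤ.< y B ℤ.+ + dy B
      sizes (inj₁ (refl , refl)) = i<i+n (x B) b , i<i+n (y B) w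
      sizes (inj₂ (refl , refl)) = i<i+n (x B) w , i<i+n (y B) b

    module _ {n} (P : Building b w (suc n)) where

      root : Box
      root = blocks P zero

      others : List Box
      others = tabulate (blocks P ∘ suc)

      ∈-blocks : ∀ i → blocks P i ∈ root ∷ others
      ∈-blocks zero    = here refl
      ∈-blocks (suc i) = there (∈-tabulate⁺ i)

      ∈-blocks⁻ : ∀ {B} → B ∈ root ∷ others → ∃ λ i → B ≡ blocks P i
      ∈-blocks⁻ (here B≡)  = zero , B≡
      ∈-blocks⁻ (there B∈) = let i , B≡ = ∈-tabulate⁻ B∈ in suc i , B≡

      explored : Explored (suc n * σ) (slots root) others
      explored = explore (suc n * σ) (slots root) others
        (sym (cong₂ _+_ (length-slots-block {B = root} (isBlock P zero)) (cong (_* σ) (List.length-tabulate (blocks P ∘ suc)))))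
        (All.tabulate⁺ (isBlock P ∘ suc))
        (AllPairs.tabulate⁺ λ {i} {j} i≢j → disjoint P (suc i) (suc j) (i≢j ∘ Fin.suc-injective))

      open Explored explored

      rest-attached : ∀ {k l} → Attached (blocks P k) (blocks P l) → blocks P k ∈ rest → blocks P l ∈ rest
      rest-attached {k} {l} att k∈ =
        let s , s∈ , cov = attached⇒covers {blocks P l} {blocks P k} (attached-sym {blocks P k} {blocks P l} att)
        in in-rest {s} {blocks P l} s∈ cov (∈-blocks l)
        where
        in-rest : ∀ {s B} → s ∈ slots B → Covers (blocks P k) s → B ∈ root ∷ others → B ∈ rest
        in-rest s∈ cov (here refl) = ⊥-elim (uncovered k∈ s∈ cov)
        in-rest s∈ cov (there B∈)  =
          [ (λ B∈D → ⊥-elim (closed k∈ B∈D s∈ cov)) , (λ B∈R → B∈R) ]′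
            (∈-++⁻ (decode (slots root) code) (Perm.∈-resp-↭ partition B∈))

      rest-connected : ∀ {k l} → Star (λ k l → Attached (blocks P k) (blocks P l)) k l → blocks P k ∈ rest → blocks P l ∈ rest
      rest-connected ε           k∈ = k∈
      rest-connected (att ◅ path) k∈ = rest-connected path (rest-attached att k∈)

      -- Along a path of attachments a leftover block would make the root leftover too. The root
      -- would then equal a block of another index, although that block is disjoint from it and a
      -- block meets itself.
      rest-∉ : ∀ {B} → ¬ B ∈ rest
      rest-∉ {B} B∈ with ∈-tabulate⁻ (Perm.∈-resp-↭ (↭-sym partition) (∈-++⁺ʳ (decode (slots root) code) B∈))
      ... | i , refl with ∈-tabulate⁻ (Perm.∈-resp-↭ (↭-sym partition)
                            (∈-++⁺ʳ (decode (slots root) code) (rest-connected (contiguous P (suc i) zero) B∈)))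
      ...   | j , root≡j = disjoint P zero (suc j) (λ ())
                (subst (InteriorsMeet root) root≡j (block-meets-itself (isBlock P zero)))

      others↭ : others ↭ decode (slots root) code
      others↭ = ↭-trans partition (↭-reflexive (trans
          (cong (decode (slots root) code ++_) (empty rest rest-∉)) (List.++-identityʳ _)))
        where
        empty : ∀ (R : List Box) → (∀ {B} → ¬ B ∈ R) → R ≡ []
        empty []      _ = refl
        empty (B ∷ R) ∉ = ⊥-elim (∉ (here refl))

      encoded : ∃ λ (c : Code m (suc n * σ) n) → others ↭ decode (slots root) c
      encoded = subst (λ j → ∃ λ (c : Code m (suc n * σ) j) → others ↭ decode (slots root) c)
        (trans (sym size) (trans (sym (Perm.↭-length others↭)) (List.length-tabulate (blocks P ∘ suc)))) (code , others↭)

      rootOrientation : Fin o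
      rootOrientation = proj₁ (orient root (isBlock P zero))

    same-root : ∀ {n} (P Q : Building b w (suc n)) → rootOrientation P ≡ rootOrientation Q → ∃ λ t → root Q ≡ shift t (root P)
    same-root P Q eq with orient (root P) (isBlock P zero) | orient (root Q) (isBlock Q zero)
    same-root P Q refl | i , dx≡ , dy≡ | i , dx≡′ , dy≡′ =
      (x (root Q) ℤ.- x (root P) , y (root Q) ℤ.- y (root P) , z (root Q) ℤ.- z (root P)) ,
      box-≡ (back (x (root P)) (x (root Q))) (back (y (root P)) (y (root Q))) (back (z (root P)) (z (root Q)))
        (trans dx≡′ (sym dx≡)) (trans dy≡′ (sym dy≡))
      where
      back : ∀ u v → v ≡ u ℤ.+ (v ℤ.- u)
      back = solve-∀
      box-≡ : ∀ {x y z dx dy x′ y′ z′ dx′ dy′} → x ≡ x′ → y ≡ y′ → z ≡ z′ → dx ≡ dx′ → dy ≡ dy′ →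
        box x y z dx dy ≡ box x′ y′ z′ dx′ dy′
      box-≡ refl refl refl refl refl = refl

    -- The roots are translates by some t, and `decode-shift` carries t over to all decoded blocks.
    -- The motion is a pure translation.
    same-code⇒identified : ∀ {n} (P Q : Building b w (suc n)) → rootOrientation P ≡ rootOrientation Q →
      proj₁ (encoded P) ≡ proj₁ (encoded Q) → Identified P Q
    same-code⇒identified P Q o≡ c≡ = let t , rootQ≡ = same-root P Q o≡ in
      from-shift t rootQ≡ (decode-image t (slots-image t {root P} {root Q} rootQ≡) c≡) (proj₂ (encoded P)) (proj₂ (encoded Q))
      where
      slots-image : ∀ t {A B} → B ≡ shift t A → slots B ≡ map (shiftSlot t) (slots A)
      slots-image t {A} refl = slots-shift t A
      decode-image : ∀ {N j} t {S S′} {c c′ : Code m N j} → S′ ≡ map (shiftSlot t) S → c ≡ c′ →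
        decode S′ c′ ≡ map (shift t) (decode S c)
      decode-image t {S} {c = c} refl refl = decode-shift t S c
      from-shift : ∀ t {D D′} → root Q ≡ shift t (root P) → D′ ≡ map (shift t) D →
        others P ↭ D → others Q ↭ D′ → Identified P Q
      from-shift t rootQ≡ D′≡ P↭ Q↭ = 0 , t ,
        (λ i → ∈-blocks⁻ Q (Perm.∈-resp-↭ (↭-sym Q↭P) (∈-map⁺ (shift t) (∈-blocks P i)))) ,
        (λ j → let B , B∈ , e = ∈-map⁻ (shift t) (Perm.∈-resp-↭ Q↭P (∈-blocks Q j)) ; i , e′ = ∈-blocks⁻ P B∈ in
               i , sym (trans e (cong (shift t) e′)))
        where
        Q↭P : root Q ∷ others Q ↭ map (shift t) (root P ∷ others P)
        Q↭P = ↭-trans (↭-reflexive (cong (_∷ others Q) rootQ≡)) (prep (shift t (root P))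
          (↭-trans Q↭ (↭-trans (↭-reflexive D′≡) (↭-sym (Perm.map⁺ (shift t) P↭)))))

    -- The key depends on the chosen representative and on its block of index zero. It is still
    -- injective, since equal keys give identified representatives.
    building-count≤ : ∀ {n t} → HasSize (buildings b w (suc n)) t → t ≤ o * codes m (suc n * σ) n
    building-count≤ {n} {t} count = Fin.injective⇒≤ {f = key} key-injective
      where
      open Bijection count using (to; injective)
      key : Fin t → Fin (o * codes m (suc n * σ) n)
      key i = combine (rootOrientation (to i)) (index (proj₁ (encoded (to i))))
      key-injective : ∀ {i j} → key i ≡ key j → i ≡ j
      key-injective {i} {j} eq =
        let o≡ , index≡ = Fin.combine-injective (rootOrientation (to i)) _ (rootOrientation (to j)) _ eq
        in injective (same-code⇒identified (to i) (to j) o≡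
             (index-injective (proj₁ (encoded (to i))) (proj₁ (encoded (to j))) index≡))

-- Estimating the number of codes

*-^ : ∀ m n k → (m * n) ^ k ≡ m ^ k * n ^ k
*-^ m n zero    = refl
*-^ m n (suc k) = trans (cong (m * n *_) (*-^ m n k)) (ℕ.[m*n]*[o*p]≡[m*o]*[n*p] m n (m ^ k) (n ^ k))

-- codes m N j is C(N , j) m ^ j, and C(N , j) q ^ (N - j) is one term of (1 + q) ^ N.
codes-weighted : ∀ m q N j → codes m N j * q ^ N ≤ (m * q) ^ j * suc q ^ N
codes-weighted m q zero    zero    = ℕ.≤-refl
codes-weighted m q zero    (suc j) = z≤n
codes-weighted m q (suc N) zero    = begin
  codes m N 0 * (q * q ^ N)           ≡⟨ swap (codes m N 0) q (q ^ N) ⟩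
  q * (codes m N 0 * q ^ N)           ≤⟨ ℕ.*-monoʳ-≤ q (codes-weighted m q N 0) ⟩
  q * (1 * suc q ^ N)                 ≤⟨ ℕ.*-monoˡ-≤ (1 * suc q ^ N) (ℕ.n≤1+n q) ⟩
  suc q * (1 * suc q ^ N)             ≡⟨ swap 1 (suc q) (suc q ^ N) ⟨
  1 * (suc q * suc q ^ N)             ∎
  where
  open ℕ.≤-Reasoning
  swap : ∀ c q r → c * (q * r) ≡ q * (c * r)
  swap = NatSolver.solve-∀
codes-weighted m q (suc N) (suc j) = begin
  (codes m N (suc j) + m * codes m N j) * (q * q ^ N)
    ≡⟨ split (codes m N (suc j)) m (codes m N j) q (q ^ N) ⟩
  q * (codes m N (suc j) * q ^ N) + m * q * (codes m N j * q ^ N)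
    ≤⟨ ℕ.+-mono-≤ (ℕ.*-monoʳ-≤ q (codes-weighted m q N (suc j))) (ℕ.*-monoʳ-≤ (m * q) (codes-weighted m q N j)) ⟩
  q * ((m * q) * (m * q) ^ j * suc q ^ N) + m * q * ((m * q) ^ j * suc q ^ N)
    ≡⟨ merge q (m * q) ((m * q) ^ j) (suc q ^ N) ⟩
  (m * q) * (m * q) ^ j * (suc q * suc q ^ N) ∎
  where
  open ℕ.≤-Reasoning
  split : ∀ c m d q r → (c + m * d) * (q * r) ≡ q * (c * r) + m * q * (d * r)
  split = NatSolver.solve-∀
  merge : ∀ q p r s → q * (p * r * s) + p * (r * s) ≡ p * r * ((1 + q) * s)
  merge = NatSolver.solve-∀

weighted-count : ∀ m q n {o t} .{{_ : NonZero m}} .{{_ : NonZero q}} →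
  t ≤ o * codes m (suc n * suc q) n →
  t * (q ^ q) ^ suc n ≤ o * (m * suc q ^ suc q) ^ suc n
weighted-count m q n {o} {t} t≤ = ℕ.*-cancelʳ-≤ (t * (q ^ q) ^ suc n) (o * (m * suc q ^ suc q) ^ suc n) (q ^ suc n) {{ℕ.m^n≢0 q (suc n)}}
  (begin
  t * (q ^ q) ^ suc n * q ^ suc n         ≡⟨ ℕ.*-assoc t ((q ^ q) ^ suc n) (q ^ suc n) ⟩
  t * ((q ^ q) ^ suc n * q ^ suc n)       ≡⟨ cong (t *_) q^N ⟨
  t * q ^ N                               ≤⟨ ℕ.*-monoˡ-≤ (q ^ N) t≤ ⟩
  o * codes m N n * q ^ N                 ≡⟨ ℕ.*-assoc o (codes m N n) (q ^ N) ⟩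
  o * (codes m N n * q ^ N)               ≤⟨ ℕ.*-monoʳ-≤ o (codes-weighted m q N n) ⟩
  -- Raising the exponent from n to n + 1 costs a constant factor and lets q ^ (n + 1) cancel.
  o * ((m * q) ^ n * suc q ^ N)           ≤⟨ ℕ.*-monoʳ-≤ o (ℕ.*-monoˡ-≤ (suc q ^ N)
                                               (ℕ.m≤n*m ((m * q) ^ n) (m * q) {{ℕ.m*n≢0 m q}})) ⟩
  o * ((m * q) ^ suc n * suc q ^ N)       ≡⟨ cong₂ (λ u v → o * (u * v)) (*-^ m q (suc n)) σ^N ⟩
  o * (m ^ suc n * q ^ suc n * (suc q ^ suc q) ^ suc n) ≡⟨ regroup o (m ^ suc n) (q ^ suc n) ((suc q ^ suc q) ^ suc n) ⟩
  o * (m ^ suc n * (suc q ^ suc q) ^ suc n) * q ^ suc n ≡⟨ cong (λ u → o * u * q ^ suc n) (*-^ m (suc q ^ suc q) (suc n)) ⟨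
  o * (m * suc q ^ suc q) ^ suc n * q ^ suc n ∎)
  where
  open ℕ.≤-Reasoning
  N = suc n * suc q
  σ^N : suc q ^ N ≡ (suc q ^ suc q) ^ suc n
  σ^N = trans (cong (suc q ^_) (ℕ.*-comm (suc n) (suc q))) (sym (ℕ.^-*-assoc (suc q) (suc q) (suc n)))
  q^N : q ^ N ≡ (q ^ q) ^ suc n * q ^ suc n
  q^N = trans (cong (q ^_) (ℕ.*-comm (suc n) (suc q))) (trans (sym (ℕ.^-*-assoc q (suc q) (suc n)))
    (trans (*-^ q (q ^ q) (suc n)) (ℕ.*-comm (q ^ suc n) ((q ^ q) ^ suc n))))
  regroup : ∀ o a q s → o * (a * q * s) ≡ o * (a * s) * q
  regroup = NatSolver.solve-∀

-- The bounds

-- Bernoulli's inequality for (1 + 1 / u) ^ k, multiplied by u ^ (k + 1).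
bernoulli-ℕ : ∀ u k → u ^ k * (u + k) ≤ u * (1 + u) ^ k
bernoulli-ℕ u zero    = ℕ.≤-reflexive (eq u)
  where
  eq : ∀ u → 1 * (u + 0) ≡ u * 1
  eq = NatSolver.solve-∀
bernoulli-ℕ u (suc k) = begin
  u * u ^ k * (u + suc k)         ≤⟨ ℕ.m≤m+n _ (u ^ k * k) ⟩
  u * u ^ k * (u + suc k) + u ^ k * k ≡⟨ expand u k (u ^ k) ⟩
  (1 + u) * (u ^ k * (u + k))     ≤⟨ ℕ.*-monoʳ-≤ (1 + u) (bernoulli-ℕ u k) ⟩
  (1 + u) * (u * (1 + u) ^ k)     ≡⟨ swap (1 + u) u ((1 + u) ^ k) ⟩
  u * ((1 + u) * (1 + u) ^ k)     ∎
  where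
  open ℕ.≤-Reasoning
  expand : ∀ u k r → u * r * (u + (1 + k)) + r * k ≡ (1 + u) * (r * (u + k))
  expand = NatSolver.solve-∀
  swap : ∀ a u r → a * (u * r) ≡ u * (a * r)
  swap = NatSolver.solve-∀

-- For v > 0, Bernoulli gives (1 + 1 / v) ^ (v + 1) ≥ 1 + (v + 1) / v ≥ 2.
2*v^[1+v]≤[1+v]^[1+v] : ∀ v → 2 * v ^ suc v ≤ suc v ^ suc v
2*v^[1+v]≤[1+v]^[1+v] zero      = z≤n
2*v^[1+v]≤[1+v]^[1+v] v@(suc _) = ℕ.*-cancelˡ-≤ v (begin
  v * (2 * v ^ suc v)         ≡⟨ eq v (v ^ suc v) ⟩
  v ^ suc v * (v + v)         ≤⟨ ℕ.*-monoʳ-≤ (v ^ suc v) (ℕ.+-monoʳ-≤ v (ℕ.n≤1+n v)) ⟩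
  v ^ suc v * (v + suc v)     ≤⟨ bernoulli-ℕ v (suc v) ⟩
  v * suc v ^ suc v           ∎)
  where
  open ℕ.≤-Reasoning
  eq : ∀ v r → v * (2 * r) ≡ r * (v + v)
  eq = NatSolver.solve-∀

-- With two orientations m and σ are both K = 2 b w, so m σ ^ σ is K ^ (K + 1).
count-ratio : ∀ K {n t} → 1 < K → t ≤ 2 * codes K (suc n * K) n →
  t * ((K ∸ 1) ^ (K ∸ 1)) ^ suc n ≤ 2 * (K ^ (K + 1)) ^ suc n
count-ratio (suc q) {n} {t} (s≤s 0<q) t≤ =
  subst (λ e → t * (q ^ q) ^ suc n ≤ 2 * (suc q ^ e) ^ suc n) (ℕ.+-comm 1 (suc q))
    (weighted-count (suc q) q n {2} {{_}} {{>-nonZero 0<q}} t≤)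

-- The bound that the count gives for square blocks is m (2 m) ^ (2 m) / (2 m - 1) ^ (2 m - 1);
-- it is below the required one since 2 (2 m - 2) ^ (2 m - 1) ≤ (2 m - 1) ^ (2 m - 1).
square-ratio : ∀ m .{{_ : NonZero m}} {n t} → t ≤ 1 * codes m (suc n * (2 * m)) n →
  t * ((m ∸ 1) ^ (2 * m ∸ 1)) ^ suc n ≤ 1 * (m ^ (2 * m + 1)) ^ suc n
square-ratio m@(suc u) {n} {t} t≤ = ℕ.*-cancelʳ-≤ (t * d ^ suc n) (1 * M ^ suc n) ((q ^ q) ^ suc n)
  {{ℕ.m^n≢0 (q ^ q) (suc n) {{ℕ.m^n≢0 q q}}}} (begin
  t * d ^ suc n * (q ^ q) ^ suc n             ≡⟨ swap t (d ^ suc n) ((q ^ q) ^ suc n) ⟩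
  t * (q ^ q) ^ suc n * d ^ suc n             ≤⟨ ℕ.*-monoˡ-≤ (d ^ suc n) (weighted-count m q n {1}
                                                   (subst (λ K → t ≤ 1 * codes m (suc n * K) n) 2m≡ t≤)) ⟩
  1 * (m * suc q ^ suc q) ^ suc n * d ^ suc n ≡⟨ cong (_* d ^ suc n) (ℕ.*-identityˡ ((m * suc q ^ suc q) ^ suc n)) ⟩
  (m * suc q ^ suc q) ^ suc n * d ^ suc n     ≡⟨ *-^ (m * suc q ^ suc q) d (suc n) ⟨
  (m * suc q ^ suc q * d) ^ suc n             ≤⟨ ℕ.^-monoˡ-≤ (suc n) base ⟩
  (M * q ^ q) ^ suc n                         ≡⟨ *-^ M (q ^ q) (suc n) ⟩
  M ^ suc n * (q ^ q) ^ suc n                 ≡⟨ cong (_* (q ^ q) ^ suc n) (ℕ.*-identityˡ (M ^ suc n)) ⟨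
  1 * M ^ suc n * (q ^ q) ^ suc n             ∎)
  where
  open ℕ.≤-Reasoning
  v = 2 * u
  q = suc v
  d = u ^ (2 * m ∸ 1)
  M = m ^ (2 * m + 1)
  2m≡ : 2 * m ≡ suc q
  2m≡ = eq u
    where
    eq : ∀ u → 2 * (1 + u) ≡ 2 + 2 * u
    eq = NatSolver.solve-∀
  swap : ∀ t d r → t * d * r ≡ t * r * d
  swap = NatSolver.solve-∀
  regroup : ∀ m a r s → m * (2 * a * (m * r)) * s ≡ m * (m * r) * (2 * (a * s))
  regroup = NatSolver.solve-∀
  -- Of the q + 1 factors 2 in (2 m) ^ (q + 1), q combine with u ^ q into v ^ q, where v = 2 m - 2;
  -- the remaining one is the 2 of the preceding inequality.
  base : m * suc q ^ suc q * d ≤ M * q ^ q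
  base = begin
    m * suc q ^ suc q * d                     ≡⟨ cong₂ (λ K e → m * K ^ suc q * u ^ e) (sym 2m≡) (cong (_∸ 1) 2m≡) ⟩
    m * (2 * m) ^ suc q * u ^ q               ≡⟨ cong (λ r → m * r * u ^ q) (*-^ 2 m (suc q)) ⟩
    m * (2 * 2 ^ q * (m * m ^ q)) * u ^ q     ≡⟨ regroup m (2 ^ q) (m ^ q) (u ^ q) ⟩
    m * (m * m ^ q) * (2 * (2 ^ q * u ^ q))   ≡⟨ cong (λ r → m * (m * m ^ q) * (2 * r)) (*-^ 2 u q) ⟨
    m * (m * m ^ q) * (2 * v ^ q)             ≤⟨ ℕ.*-monoʳ-≤ (m * (m * m ^ q)) (2*v^[1+v]≤[1+v]^[1+v] v) ⟩
    m ^ suc (suc q) * q ^ q                   ≡⟨ cong (λ e → m ^ e * q ^ q) (trans (cong suc (sym 2m≡)) (ℕ.+-comm 1 (2 * m))) ⟩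
    M * q ^ q                                 ∎

oblong-count≤ : ∀ b w .{{_ : NonZero b}} .{{_ : NonZero w}} {n t} → HasSize (buildings b w (suc n)) t →
  t ≤ 2 * codes (2 * (b * w)) (suc n * (2 * (b * w))) n
oblong-count≤ b w = building-count≤
  where
  orientation : Fin 2 → Bool
  orientation zero    = false
  orientation (suc _) = true
  orient : ∀ B → IsBlock b w B → ∃ λ i → dx B ≡ side₁ b w (orientation i) × dy B ≡ side₂ b w (orientation i)
  orient B (inj₁ sides) = zero , sides
  orient B (inj₂ sides) = suc zero , sides
  open Exploration b w orientation orient

square-count≤ : ∀ b .{{_ : NonZero b}} {n t} → HasSize (buildings b b (suc n)) t →
  t ≤ 1 * codes (1 * (b * b)) (suc n * (2 * (b * b))) n
square-count≤ b = building-count≤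
  where
  orient : ∀ B → IsBlock b b B → ∃ λ (i : Fin 1) → dx B ≡ b × dy B ≡ b
  orient B (inj₁ sides) = zero , sides
  orient B (inj₂ sides) = zero , sides
  open Exploration b b (λ _ → false) orient

0<2*b∸1 : ∀ b .{{_ : NonZero b}} → 0 < 2 * b ∸ 1
0<2*b∸1 b = ℕ.m<n⇒0<n∸m (ℕ.*-monoʳ-≤ 2 {1} {b} (>-nonZero⁻¹ b))

-- Keeps the junk value of log 0 out of the limit; the towers provide the positivity.
positive-count : ∀ {A} n {t} → 0 < A → A ^ n ≤ 4 * t → 0 < t
positive-count {A} n {zero} 0<A A^n≤ with ℕ.≤-trans (>-nonZero⁻¹ (A ^ n) {{ℕ.m^n≢0 A n {{>-nonZero 0<A}}}}) A^n≤
... | ()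
positive-count n {suc t} _ _ = s≤s z≤n

x*x≡x^2 : ∀ x → x * x ≡ x ^ 2
x*x≡x^2 x = cong (x *_) (sym (ℕ.*-identityʳ x))

module _ {T : ℕ → ℕ} {s : ℝ} (limit : ConvergesTo (λ n → log (T n) /ᵣ n) s) where

  entropy-bounds : ∀ {A M C} d → 0 < A → 0 < M → 0 < C →
    (∀ n → A ^ n ≤ 4 * T (suc n)) → (∀ n → T (suc n) * d ^ suc n ≤ C * M ^ suc n) →
    (fromℕ A ≤ᵣ exp s) × (exp s ≤ᵣ M // d)
  entropy-bounds {A} {M} {C} d 0<A 0<M 0<C A^n≤ ≤M^n =
    growth≤ {T} {s} limit positive-T {A} {4} 0<A (s≤s z≤n) A^n≤ , upper d ≤M^n
    where
    positive-T : ∀ n → 0 < T (suc n)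
    positive-T n = positive-count n 0<A (A^n≤ n)
    upper : ∀ d → (∀ n → T (suc n) * d ^ suc n ≤ C * M ^ suc n) → exp s ≤ᵣ M // d
    -- This is the case b = w = 1, where the bound is + ∞.
    upper zero    _    = tt
    upper (suc d) ≤M^n = ≤growth {T} {s} limit positive-T d 0<M 0<C ≤M^n

theorem2p10 : (b w : ℕ) .{{_ : NonZero b}} .{{_ : NonZero w}} (s : ℝ) → IsEntropy b w s →
    let h = exp s in
    (b ≢ w →
    (fromℕ ((2 * b ∸ 1) * (2 * w ∸ 1) + (b + w ∸ 1) ^ 2) ≤ᵣ h) ×
    (h ≤ᵣ (2 * b * w) ^ (2 * b * w + 1) // (2 * b * w ∸ 1) ^ (2 * b * w ∸ 1))) ×
    (b ≡ w →
    (fromℕ ((2 * b ∸ 1) ^ 2) ≤ᵣ h) ×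
    (h ≤ᵣ (b ^ 2) ^ (2 * b ^ 2 + 1) // (b ^ 2 ∸ 1) ^ (2 * b ^ 2 ∸ 1)))
theorem2p10 b w s (T , count , limit) = oblong , square
  where
  oblong : b ≢ w →
    (fromℕ ((2 * b ∸ 1) * (2 * w ∸ 1) + (b + w ∸ 1) ^ 2) ≤ᵣ exp s) ×
    (exp s ≤ᵣ (2 * b * w) ^ (2 * b * w + 1) // (2 * b * w ∸ 1) ^ (2 * b * w ∸ 1))
  oblong b≢w = entropy-bounds {T} {s} limit ((2 * b * w ∸ 1) ^ (2 * b * w ∸ 1))
    (ℕ.≤-trans (ℕ.*-mono-≤ (0<2*b∸1 b) (0<2*b∸1 w)) (ℕ.m≤m+n _ ((b + w ∸ 1) ^ 2)))
    (>-nonZero⁻¹ _ {{ℕ.m^n≢0 (2 * b * w) (2 * b * w + 1) {{ℕ.m*n≢0 (2 * b) w {{ℕ.m*n≢0 2 b}}}}}})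
    -- Fixes C = 2, one for each orientation of the root; for square blocks C = 1.
    (s≤s (z≤n {1}))
    (λ n → subst (λ e → ((2 * b ∸ 1) * (2 * w ∸ 1) + e) ^ n ≤ 4 * T (suc n)) (x*x≡x^2 (b + w ∸ 1))
      (tower-count b w b≢w (count (suc n))))
    (λ n → subst (λ K → T (suc n) * ((K ∸ 1) ^ (K ∸ 1)) ^ suc n ≤ 2 * (K ^ (K + 1)) ^ suc n) (sym (ℕ.*-assoc 2 b w))
      (count-ratio (2 * (b * w)) (ℕ.*-monoʳ-≤ 2 (>-nonZero⁻¹ (b * w) {{ℕ.m*n≢0 b w}})) (oblong-count≤ b w (count (suc n)))))
  square : b ≡ w →
    (fromℕ ((2 * b ∸ 1) ^ 2) ≤ᵣ exp s) ×
    (exp s ≤ᵣ (b ^ 2) ^ (2 * b ^ 2 + 1) // (b ^ 2 ∸ 1) ^ (2 * b ^ 2 ∸ 1))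
  square refl = entropy-bounds {T} {s} limit ((b ^ 2 ∸ 1) ^ (2 * b ^ 2 ∸ 1))
    (>-nonZero⁻¹ _ {{ℕ.m^n≢0 (2 * b ∸ 1) 2 {{>-nonZero (0<2*b∸1 b)}}}})
    (>-nonZero⁻¹ _ {{ℕ.m^n≢0 (b ^ 2) (2 * b ^ 2 + 1) {{ℕ.m^n≢0 b 2}}}})
    (s≤s (z≤n {0}))
    (λ n → subst (λ A → A ^ n ≤ 4 * T (suc n)) (x*x≡x^2 (2 * b ∸ 1)) (square-tower-count b (count (suc n))))
    (λ n → square-ratio (b ^ 2) {{ℕ.m^n≢0 b 2}}
      (subst (λ m → T (suc n) ≤ 1 * codes m (suc n * (2 * m)) n) (x*x≡x^2 b)
        (subst (λ m → T (suc n) ≤ 1 * codes m (suc n * (2 * (b * b))) n) (ℕ.*-identityˡ (b * b))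
          (square-count≤ b (count (suc n))))))
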